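{- For $m\ge1$ and $n\ge2$, \[ G_{m,n}=\frac{2(-1)^{n-1}}{n!}\int_0^1\binom{t}{m}\left[{n\atop 2}\right]_{t-1}dt . \]
   Context: The generalized Gregory coefficients $G_{m,n}$ are defined by $\sum_{m,n\ge0}G_{m,n}x^my^n=\dfrac{y\log^2(1+x)-x\log^2(1+y)}{\log(1+x)-\log(1+y)}$ (formal power series; $\log^ku=(\log u)^k$). $\binom{t}{m}=t(t-1)\cdots(t-m+1)/m!$. The Stirling polynomials of the first kind $\left[{n\atop m}\right]_x\in\mathbb Z[x]$ ($n\ge m\ge0$) are defined by $\sum_{m=0}^n\left[{n\atop m}\right]_x y^m=(x+y)(x+y+1)\cdots(x+y+n-1)$; equivalently $(1-t)^{ -x}\frac{(-1)^m}{m!}\log^m(1-t)=\sum_{n\ge m}\left[{n\atop m}\right]_x\frac{t^n}{n!}$. -}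

module Defs where

open import Level using (0ℓ)
open import Algebra.Bundles using (RawRing)
import Algebra.Definitions.RawSemiring as RawSemiringDefinitions
open import Data.Fin.Base using (toℕ)
open import Data.Integer.Base as ℤ using (ℤ; +_; -1ℤ)
open import Data.List.Base using (List; []; _∷_; map; foldr)
open import Data.Nat.Base as ℕ using (ℕ; zero; suc; _∸_; _!)
open import Data.Nat.Properties using (_!≢0)
open import Data.Product.Base using (∃; _×_)
open import Data.Rational.Base as ℚ using (ℚ; 0ℚ; 1ℚ; _/_; ∣_∣)
open import Data.Unit.Base using (⊤)
open import Relation.Binary.PropositionalEquality using (_≡_)

open RawSemiringDefinitions (RawRing.rawSemiring ℚ.+-*-rawRing)
  using () renaming (sum to ∑; product to ∏)

-- F m n is the coefficient of x^m y^n.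
Series : Set
Series = ℕ → ℕ → ℚ

infix  4 _≈ₛ_
infixl 6 _-ₛ_
infixl 7 _*ₛ_
infixr 8 _²

_≈ₛ_ : Series → Series → Set
F ≈ₛ G = ∀ m n → F m n ≡ G m n

_-ₛ_ : Series → Series → Series
(F -ₛ G) m n = F m n ℚ.- G m n

_*ₛ_ : Series → Series → Series
(F *ₛ G) m n =
  ∑ {suc m} λ i → ∑ {suc n} λ j →
    F (toℕ i) (toℕ j) ℚ.* G (m ∸ toℕ i) (n ∸ toℕ j)

_² : Series → Series
F ² = F *ₛ F

-- A univariate series, read as a series in x alone or in y alone.
inX : (ℕ → ℚ) → Series
inX f m zero    = f m
inX f m (suc n) = 0ℚ

inY : (ℕ → ℚ) → Series
inY f zero    n = f n
inY f (suc m) n = 0ℚ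

-- The series t.
var : ℕ → ℚ
var 1 = 1ℚ
var _ = 0ℚ

-- log(1+t) = ∑_{k≥1} (-1)^(k-1) t^k / k.
log1+ : ℕ → ℚ
log1+ zero    = 0ℚ
log1+ (suc k) = (-1ℤ ℤ.^ k) / suc k

-- Q is the quotient N / D.  As ℚ[[x,y]] is an integral domain, Q is unique
-- when D is nonzero; D need not be invertible.
_IsQuotient_Over_ : Series → Series → Series → Set
Q IsQuotient N Over D = D *ₛ Q ≈ₛ N

-- The quotient exists: numerator and denominator are both divisible by x - y,
-- and the denominator is (x - y) times a series with constant term 1.
IsGeneralizedGregory : (ℕ → ℕ → ℚ) → Set
IsGeneralizedGregory G =
  G IsQuotient (y *ₛ logX ² -ₛ x *ₛ logY ²) Over (logX -ₛ logY)
  where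
  x y logX logY : Series
  x    = inX var
  y    = inY var
  logX = inX log1+
  logY = inY log1+

module Polynomials (R : RawRing 0ℓ 0ℓ) where
  open RawRing R

  -- a₀ ∷ a₁ ∷ a₂ ∷ … is a₀ + a₁ t + a₂ t² + …; trailing zeros are allowed.
  Poly : Set
  Poly = List Carrier

  coeff : Poly → ℕ → Carrier
  coeff []      _       = 0#
  coeff (a ∷ p) zero    = a
  coeff (a ∷ p) (suc k) = coeff p k

  const : Carrier → Poly
  const a = a ∷ []

  indeterminate : Poly
  indeterminate = 0# ∷ 1# ∷ []

  add : Poly → Poly → Poly
  add []      q       = q
  add (a ∷ p) []      = a ∷ p
  add (a ∷ p) (b ∷ q) = (a + b) ∷ add p q

  mul : Poly → Poly → Poly
  mul []      q = []
  mul (a ∷ p) q = add (map (a *_) q) (0# ∷ mul p q)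

  polyRing : RawRing 0ℓ 0ℓ
  polyRing = record
    { Carrier = Poly
    ; _≈_     = λ p q → ∀ k → coeff p k ≈ coeff q k
    ; _+_     = add
    ; _*_     = mul
    ; -_      = map -_
    ; 0#      = []
    ; 1#      = const 1#
    }

ℤ[x] : RawRing 0ℓ 0ℓ
ℤ[x] = Polynomials.polyRing ℤ.+-*-rawRing

ℤ[x][y] : RawRing 0ℓ 0ℓ
ℤ[x][y] = Polynomials.polyRing ℤ[x]

-- stirling n m is the coefficient of y^m in (x+y)(x+y+1)⋯(x+y+n-1).
stirling : ℕ → ℕ → RawRing.Carrier ℤ[x]
stirling n m = Pxy.coeff (product {n} λ i → x + y + fromℕ (toℕ i)) m
  where
  module Px  = Polynomials ℤ.+-*-rawRing
  module Pxy = Polynomials ℤ[x]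
  open RawRing ℤ[x][y] using (Carrier; _+_)
  open RawSemiringDefinitions (RawRing.rawSemiring ℤ[x][y]) using (product)

  x y : Carrier
  x = Pxy.const Px.indeterminate
  y = Pxy.indeterminate

  fromℕ : ℕ → Carrier
  fromℕ i = Pxy.const (Px.const (+ i))

eval : RawRing.Carrier ℤ[x] → ℚ → ℚ
eval p s = foldr (λ a v → a / 1 ℚ.+ s ℚ.* v) 0ℚ p

binom : ℚ → ℕ → ℚ
binom t m =
  (∏ {m} λ i → t ℚ.- + toℕ i / 1) ℚ.* ((+ 1 / (m !)) {{m !≢0}})

-- Tagged partitions of [a,b] with rational division points and tags.
data TaggedPartition : ℚ → ℚ → Set where
  end  : ∀ {a} → TaggedPartition a a
  cell : ∀ {a b} (tag c : ℚ) → a ℚ.≤ tag → tag ℚ.≤ c →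
         TaggedPartition c b → TaggedPartition a b

riemannSum : (ℚ → ℚ) → ∀ {a b} → TaggedPartition a b → ℚ
riemannSum f end                    = 0ℚ
riemannSum f (cell {a} tag c _ _ P) = f tag ℚ.* (c ℚ.- a) ℚ.+ riemannSum f P

MeshBelow : ℚ → ∀ {a b} → TaggedPartition a b → Set
MeshBelow δ end                    = ⊤
MeshBelow δ (cell {a} tag c _ _ P) = (c ℚ.- a) ℚ.< δ × MeshBelow δ P

-- ∫_a^b f(t) dt = I for a ≤ b, as the limit of Riemann sums.  For a polynomial
-- f (continuous on the real interval), rational partitions and tags determine
-- the same limit as real ones.
HasIntegral : (ℚ → ℚ) → ℚ → ℚ → ℚ → Set
HasIntegral f a b I =
  ∀ ε → 0ℚ ℚ.< ε → ∃ λ δ → 0ℚ ℚ.< δ ×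
    (∀ (P : TaggedPartition a b) → MeshBelow δ P →
      ∣ riemannSum f P ℚ.- I ∣ ℚ.< ε)

{-# OPTIONS --safe #-}
-- Write u = log(1+x), v = log(1+y), B_m(t) = binom(t, m) and A_n(t) = binom(1-t, n).
-- The product (t-1+y)(t+y)⋯(t+n-2+y) is (-1)^n n! binom(1-t-y, n), so its y²-coefficient
-- [n over 2] at t - 1 is ½ (-1)^n n! A_n″(t), and the claim reads G_{m,n} = -J_{m,n} with
-- J_{m,n} = ∫₀¹ B_m A_n″.  Multiplication by u acts on (1+x)^t as d/dt, and
-- multiplication by v acts on (1+y)^(1-t) as -d/dt, so (u - v) ∑ J_{m,n} x^m y^n has the
-- coefficients ∫₀¹ (B_m A_n″)′; evaluating at the end points gives (x - y) v².  Hence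
-- y(u + v) - J solves the defining equation of G, whose solution is unique, and
-- y(u + v) has no terms with m ≥ 1 and n ≥ 2.
module Submission where

open import Defs
open import Data.Integer.Base as ℤ using (+_; -1ℤ)
open import Data.Nat.Base using (ℕ; _≤_; _∸_; _!)
open import Data.Nat.Properties using (_!≢0)
open import Data.Product.Base using (∃; _×_)
open import Data.Rational.Base as ℚ using (ℚ; 0ℚ; 1ℚ; _/_)
open import Relation.Binary.PropositionalEquality using (_≡_)

open import Algebra.Bundles using (RawRing)
import Algebra.Definitions.RawSemiring as RawSemiringDefinitions
open import Data.Empty using (⊥-elim)
open import Data.Fin.Base as Fin using (Fin; toℕ)
import Data.Integer.Properties as ℤ
open import Data.List.Base using ([]; _∷_; map)
open import Data.List.Relation.Unary.All using (All; []; _∷_)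
open import Data.Nat.Base as ℕ using (zero; suc; _<_; z≤n; s≤s)
open import Data.Nat.Induction using (<-rec)
import Data.Nat.Properties as ℕ
open import Data.Product.Base using (_,_; proj₁; proj₂)
open import Data.Rational.Base using (½; _+_; _*_; -_; _-_; ∣_∣; fromℚᵘ)
import Data.Rational.Properties as ℚ
open import Data.Rational.Unnormalised.Base as ℚᵘ using (mkℚᵘ; *≡*)
import Data.Rational.Unnormalised.Properties as ℚᵘ
open import Function.Base using (_∘_)
open import Relation.Binary.PropositionalEquality using (refl; sym; trans; cong; cong₂; subst; _≗_)
open import Relation.Nullary using (yes; no)
open import Relation.Nullary.Decidable.Core using (dec⇒maybe)
open import Tactic.RingSolver using (solve-∀)
open import Tactic.RingSolver.Core.AlmostCommutativeRing
  using (AlmostCommutativeRing; fromCommutativeRing)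
open import Algebra.Properties.CommutativeMonoid.Sum ℚ.+-0-commutativeMonoid
  using () renaming (sum to ∑; sum-cong-≗ to ∑-cong; sum-replicate-zero to ∑-zero)
open import Algebra.Properties.CommutativeMonoid.Sum ℚ.*-1-commutativeMonoid
  using () renaming (sum to ∏)
open Polynomials ℚ.+-*-rawRing using (Poly; const; add; mul)
open ℚ.≤-Reasoning

-- Behind `J` stands a closed form. `A″ n` at t is the coefficient of y^n in v² (1+y)^(1-t), so the
-- double series of `J` is v² ∫₀¹ (1+x)^t (1+y)^(1-t) dt, that is (x - y) v² / (u - v). As u - v has
-- no inverse among power series, the equation is kept multiplied out and u - v is cancelled only at
-- the end. The integral is formal almost throughout: `∫₀¹` is a linear functional on coefficient
-- lists, obeying integration by parts by algebra alone. Analysis enters once, to identify it with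
-- the limit of Riemann sums. A coefficient list may carry trailing zeros, so identities between
-- polynomials are stated for their values. Differentiating or integrating such an identity needs a
-- way back from values to coefficients: a polynomial that vanishes on the rationals of (0,1] has
-- only zero coefficients.

ring : AlmostCommutativeRing _ _
ring = fromCommutativeRing ℚ.+-*-commutativeRing λ x → dec⇒maybe (0ℚ ℚ.≟ x)

-- Arithmetic of fractions

fromℚᵘ-homo-+ : ∀ p q → fromℚᵘ (p ℚᵘ.+ q) ≡ fromℚᵘ p + fromℚᵘ q
fromℚᵘ-homo-+ p q = begin-equality
  fromℚᵘ (p ℚᵘ.+ q)
    ≡⟨ ℚ.fromℚᵘ-cong (ℚᵘ.+-cong (ℚᵘ.≃-sym (ℚ.toℚᵘ-fromℚᵘ p)) (ℚᵘ.≃-sym (ℚ.toℚᵘ-fromℚᵘ q))) ⟩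
  fromℚᵘ (ℚ.toℚᵘ (fromℚᵘ p) ℚᵘ.+ ℚ.toℚᵘ (fromℚᵘ q))
    ≡⟨ ℚ.fromℚᵘ-cong (ℚᵘ.≃-sym (ℚ.toℚᵘ-homo-+ (fromℚᵘ p) (fromℚᵘ q))) ⟩
  fromℚᵘ (ℚ.toℚᵘ (fromℚᵘ p + fromℚᵘ q))  ≡⟨ ℚ.fromℚᵘ-toℚᵘ _ ⟩
  fromℚᵘ p + fromℚᵘ q                    ∎

fromℚᵘ-homo-* : ∀ p q → fromℚᵘ (p ℚᵘ.* q) ≡ fromℚᵘ p * fromℚᵘ q
fromℚᵘ-homo-* p q = begin-equality
  fromℚᵘ (p ℚᵘ.* q)
    ≡⟨ ℚ.fromℚᵘ-cong (ℚᵘ.*-cong (ℚᵘ.≃-sym (ℚ.toℚᵘ-fromℚᵘ p)) (ℚᵘ.≃-sym (ℚ.toℚᵘ-fromℚᵘ q))) ⟩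
  fromℚᵘ (ℚ.toℚᵘ (fromℚᵘ p) ℚᵘ.* ℚ.toℚᵘ (fromℚᵘ q))
    ≡⟨ ℚ.fromℚᵘ-cong (ℚᵘ.≃-sym (ℚ.toℚᵘ-homo-* (fromℚᵘ p) (fromℚᵘ q))) ⟩
  fromℚᵘ (ℚ.toℚᵘ (fromℚᵘ p * fromℚᵘ q))  ≡⟨ ℚ.fromℚᵘ-toℚᵘ _ ⟩
  fromℚᵘ p * fromℚᵘ q                    ∎

-- `a / 1` is `fromℚᵘ (mkℚᵘ a 0)` by definition, so sums and products of fractions are computed
-- among the unnormalised rationals, where no gcd intervenes.
/1-homo-+ : ∀ a b → (a ℤ.+ b) / 1 ≡ a / 1 + b / 1
/1-homo-+ a b = begin-equality
  (a ℤ.+ b) / 1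
    ≡⟨ cong (λ c → fromℚᵘ (mkℚᵘ c 0)) (cong₂ ℤ._+_ (ℤ.*-identityʳ a) (ℤ.*-identityʳ b)) ⟨
  fromℚᵘ (mkℚᵘ a 0 ℚᵘ.+ mkℚᵘ b 0)
    ≡⟨ fromℚᵘ-homo-+ (mkℚᵘ a 0) (mkℚᵘ b 0) ⟩
  a / 1 + b / 1 ∎

/1-homo-* : ∀ a b → (a ℤ.* b) / 1 ≡ a / 1 * (b / 1)
/1-homo-* a b = fromℚᵘ-homo-* (mkℚᵘ a 0) (mkℚᵘ b 0)

ι : ℕ → ℚ
ι n = + n / 1

ι-suc : ∀ n → ι (suc n) ≡ 1ℚ + ι n
ι-suc n = /1-homo-+ (+ 1) (+ n)

/-*-cancel : ∀ a d .{{_ : ℕ.NonZero d}} → a / d * ι d ≡ a / 1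
/-*-cancel a (suc k) = trans
  (sym (fromℚᵘ-homo-* (mkℚᵘ a k) (mkℚᵘ (+ suc k) 0)))
  (ℚ.fromℚᵘ-cong {mkℚᵘ a k ℚᵘ.* mkℚᵘ (+ suc k) 0} {mkℚᵘ a 0} (*≡* (ℤ.*-assoc a (+ suc k) (+ 1))))

ι-cancel : ∀ n {x y} → ι (suc n) * x ≡ ι (suc n) * y → x ≡ y
ι-cancel n {x} {y} eq = begin-equality
  x                     ≡⟨ undo x ⟩
  r * (ι (suc n) * x)   ≡⟨ cong (r *_) eq ⟩
  r * (ι (suc n) * y)   ≡⟨ undo y ⟨
  y                     ∎
  where
  r = + 1 / suc n
  undo : ∀ z → z ≡ r * (ι (suc n) * z)
  undo z = begin-equality
    z                    ≡⟨ ℚ.*-identityˡ z ⟨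
    1ℚ * z               ≡⟨ cong (_* z) (/-*-cancel (+ 1) (suc n)) ⟨
    (r * ι (suc n)) * z  ≡⟨ ℚ.*-assoc r (ι (suc n)) z ⟩
    r * (ι (suc n) * z)  ∎

∑-minus : ∀ {n} (f g : Fin n → ℚ) → ∑ {n} (λ i → f i - g i) ≡ ∑ {n} f - ∑ {n} g
∑-minus {zero}  f g = refl
∑-minus {suc n} f g = trans
  (cong (_+_ (f Fin.zero - g Fin.zero)) (∑-minus {n} (f ∘ Fin.suc) (g ∘ Fin.suc)))
  (lem (f Fin.zero) (g Fin.zero) (∑ {n} (f ∘ Fin.suc)) (∑ {n} (g ∘ Fin.suc)))
  where
  lem : ∀ a b c d → (a - b) + (c - d) ≡ (a + c) - (b + d)
  lem = solve-∀ ring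

∑-0* : ∀ n (f : Fin n → ℚ) → ∑ {n} (λ i → 0ℚ * f i) ≡ 0ℚ
∑-0* n f = trans (∑-cong {n} λ i → ℚ.*-zeroˡ (f i)) (∑-zero n)

-- Univariate power series

infixl 7 _⋆_

-- The Cauchy product. At `suc n` it unfolds by computation to
-- `f 0 * g (suc n) + ((f ∘ suc) ⋆ g) n`, which drives the inductions below.
_⋆_ : (ℕ → ℚ) → (ℕ → ℚ) → ℕ → ℚ
(f ⋆ g) n = ∑ {suc n} λ i → f (toℕ i) * g (n ∸ toℕ i)

δ : ℕ → ℚ
δ zero    = 1ℚ
δ (suc _) = 0ℚ

shift : (ℕ → ℚ) → ℕ → ℚ
shift f zero    = 0ℚ
shift f (suc n) = f n

⋆-cong : ∀ {f f′ g g′} → f ≗ f′ → g ≗ g′ → f ⋆ g ≗ f′ ⋆ g′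
⋆-cong f≗ g≗ n = ∑-cong {suc n} λ i → cong₂ _*_ (f≗ (toℕ i)) (g≗ (n ∸ toℕ i))

⋆-+ˡ : ∀ f f′ g → (λ i → f i + f′ i) ⋆ g ≗ λ n → (f ⋆ g) n + (f′ ⋆ g) n
⋆-+ˡ f f′ g zero    = lem (f 0) (f′ 0) (g 0)
  where
  lem : ∀ a b c → (a + b) * c + 0ℚ ≡ (a * c + 0ℚ) + (b * c + 0ℚ)
  lem = solve-∀ ring
⋆-+ˡ f f′ g (suc n) = trans
  (cong (_+_ ((f 0 + f′ 0) * g (suc n))) (⋆-+ˡ (f ∘ suc) (f′ ∘ suc) g n))
  (lem (f 0) (f′ 0) (g (suc n)) (((f ∘ suc) ⋆ g) n) (((f′ ∘ suc) ⋆ g) n))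
  where
  lem : ∀ a b c d e → (a + b) * c + (d + e) ≡ (a * c + d) + (b * c + e)
  lem = solve-∀ ring

⋆-+ʳ : ∀ f g g′ → f ⋆ (λ i → g i + g′ i) ≗ λ n → (f ⋆ g) n + (f ⋆ g′) n
⋆-+ʳ f g g′ zero    = lem (f 0) (g 0) (g′ 0)
  where
  lem : ∀ a b c → a * (b + c) + 0ℚ ≡ (a * b + 0ℚ) + (a * c + 0ℚ)
  lem = solve-∀ ring
⋆-+ʳ f g g′ (suc n) = trans
  (cong (_+_ (f 0 * (g (suc n) + g′ (suc n)))) (⋆-+ʳ (f ∘ suc) g g′ n))
  (lem (f 0) (g (suc n)) (g′ (suc n)) (((f ∘ suc) ⋆ g) n) (((f ∘ suc) ⋆ g′) n))
  where
  lem : ∀ a b c d e → a * (b + c) + (d + e) ≡ (a * b + d) + (a * c + e)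
  lem = solve-∀ ring

⋆-*ʳ : ∀ c f g → f ⋆ (λ i → c * g i) ≗ λ n → c * (f ⋆ g) n
⋆-*ʳ c f g zero    = lem c (f 0) (g 0)
  where
  lem : ∀ c a b → a * (c * b) + 0ℚ ≡ c * (a * b + 0ℚ)
  lem = solve-∀ ring
⋆-*ʳ c f g (suc n) = trans
  (cong (_+_ (f 0 * (c * g (suc n)))) (⋆-*ʳ c (f ∘ suc) g n))
  (lem c (f 0) (g (suc n)) (((f ∘ suc) ⋆ g) n))
  where
  lem : ∀ c a b d → a * (c * b) + c * d ≡ c * (a * b + d)
  lem = solve-∀ ring

0⋆ : ∀ g n → ((λ _ → 0ℚ) ⋆ g) n ≡ 0ℚ
0⋆ g n = ∑-0* (suc n) λ i → g (n ∸ toℕ i)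

-- The unfolding from the other end: here `g` is the factor that gets reindexed.
⋆-snoc : ∀ f g n → (f ⋆ g) (suc n) ≡ (f ⋆ (g ∘ suc)) n + f (suc n) * g 0
⋆-snoc f g zero    = lem (f 0) (g 1) (f 1) (g 0)
  where
  lem : ∀ a b c d → a * b + (c * d + 0ℚ) ≡ (a * b + 0ℚ) + c * d
  lem = solve-∀ ring
⋆-snoc f g (suc n) = trans
  (cong (_+_ (f 0 * g (suc (suc n)))) (⋆-snoc (f ∘ suc) g n))
  (sym (ℚ.+-assoc (f 0 * g (suc (suc n))) (((f ∘ suc) ⋆ (g ∘ suc)) n) (f (suc (suc n)) * g 0)))

δ⋆ : ∀ g → δ ⋆ g ≗ g
δ⋆ g zero    = trans (ℚ.+-identityʳ (1ℚ * g 0)) (ℚ.*-identityˡ (g 0))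
δ⋆ g (suc n) = trans
  (cong₂ _+_ (ℚ.*-identityˡ (g (suc n))) (0⋆ g n))
  (ℚ.+-identityʳ (g (suc n)))

⋆δ : ∀ f → f ⋆ δ ≗ f
⋆δ f zero    = trans (ℚ.+-identityʳ (f 0 * 1ℚ)) (ℚ.*-identityʳ (f 0))
⋆δ f (suc n) = trans
  (cong₂ _+_ (ℚ.*-zeroʳ (f 0)) (⋆δ (f ∘ suc) n))
  (ℚ.+-identityˡ (f (suc n)))

⋆-shift : ∀ f g → f ⋆ shift g ≗ shift (f ⋆ g)
⋆-shift f g zero    = trans (ℚ.+-identityʳ (f 0 * 0ℚ)) (ℚ.*-zeroʳ (f 0))
⋆-shift f g (suc n) = begin-equality
  (f ⋆ shift g) (suc n)           ≡⟨ ⋆-snoc f (shift g) n ⟩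
  (f ⋆ g) n + f (suc n) * 0ℚ      ≡⟨ cong (_+_ ((f ⋆ g) n)) (ℚ.*-zeroʳ (f (suc n))) ⟩
  (f ⋆ g) n + 0ℚ                  ≡⟨ ℚ.+-identityʳ ((f ⋆ g) n) ⟩
  (f ⋆ g) n                       ∎

var≗shift-δ : var ≗ shift δ
var≗shift-δ 0             = refl
var≗shift-δ 1             = refl
var≗shift-δ (suc (suc _)) = refl

shift-cong : ∀ {f g} → f ≗ g → shift f ≗ shift g
shift-cong f≗g zero    = refl
shift-cong f≗g (suc n) = f≗g n

⋆var : ∀ f → f ⋆ var ≗ shift f
⋆var f n = begin-equality
  (f ⋆ var) n       ≡⟨ ⋆-cong {f} (λ _ → refl) var≗shift-δ n ⟩
  (f ⋆ shift δ) n   ≡⟨ ⋆-shift f δ n ⟩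
  shift (f ⋆ δ) n   ≡⟨ shift-cong (⋆δ f) n ⟩
  shift f n         ∎

var⋆ : ∀ g → var ⋆ g ≗ shift g
var⋆ g zero    = trans (ℚ.+-identityʳ (0ℚ * g 0)) (ℚ.*-zeroˡ (g 0))
var⋆ g (suc n) = begin-equality
  0ℚ * g (suc n) + ((var ∘ suc) ⋆ g) n
    ≡⟨ cong₂ _+_ (ℚ.*-zeroˡ (g (suc n))) (⋆-cong {g = g} (var≗shift-δ ∘ suc) (λ _ → refl) n) ⟩
  0ℚ + (δ ⋆ g) n     ≡⟨ ℚ.+-identityˡ ((δ ⋆ g) n) ⟩
  (δ ⋆ g) n          ≡⟨ δ⋆ g n ⟩
  g n                ∎

-- The Euler operator t d/dt on coefficients.
θ : (ℕ → ℚ) → ℕ → ℚ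
θ f i = ι i * f i

-- On each term of the product the weight n splits as i + (n - i). The induction passes to
-- `f ∘ suc`, whose index is one too low; `θ-suc` makes up for it by (i + 1) c = c + i c.
⋆-leibniz : ∀ f g → θ (f ⋆ g) ≗ λ n → (θ f ⋆ g) n + (f ⋆ θ g) n
⋆-leibniz f g zero    = lem (f 0) (g 0)
  where
  lem : ∀ a b → 0ℚ * (a * b + 0ℚ) ≡ (0ℚ * a * b + 0ℚ) + (a * (0ℚ * b) + 0ℚ)
  lem = solve-∀ ring
⋆-leibniz f g (suc n) = begin-equality
  ι (suc n) * (a * b + C)
    ≡⟨ cong (_* (a * b + C)) (ι-suc n) ⟩
  (1ℚ + ι n) * (a * b + C)
    ≡⟨ lem₁ a b C (ι n) ⟩
  (1ℚ + ι n) * (a * b) + (C + ι n * C)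
    ≡⟨ cong₂ (λ k d → k * (a * b) + (C + d)) (sym (ι-suc n)) (⋆-leibniz f⁺ g n) ⟩
  ι (suc n) * (a * b) + (C + ((θ f⁺ ⋆ g) n + (f⁺ ⋆ θ g) n))
    ≡⟨ lem₂ (ι (suc n)) a b C ((θ f⁺ ⋆ g) n) ((f⁺ ⋆ θ g) n) ⟩
  (0ℚ * a * b + (C + (θ f⁺ ⋆ g) n)) + (a * (ι (suc n) * b) + (f⁺ ⋆ θ g) n)
    ≡⟨ cong (λ d → (0ℚ * a * b + d) + (a * (ι (suc n) * b) + (f⁺ ⋆ θ g) n)) θ-suc ⟨
  (θ f ⋆ g) (suc n) + (f ⋆ θ g) (suc n) ∎
  where
  f⁺ = f ∘ suc
  a = f 0
  b = g (suc n)
  C = (f⁺ ⋆ g) n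
  θ-suc : ((θ f ∘ suc) ⋆ g) n ≡ C + (θ f⁺ ⋆ g) n
  θ-suc = trans
    (⋆-cong {g = g} (λ i → trans (cong (_* f⁺ i) (ι-suc i))
      (trans (ℚ.*-distribʳ-+ (f⁺ i) 1ℚ (ι i)) (cong (_+ θ f⁺ i) (ℚ.*-identityˡ (f⁺ i)))))
      (λ _ → refl) n)
    (⋆-+ˡ f⁺ (θ f⁺) g n)
  lem₁ : ∀ a b C k → (1ℚ + k) * (a * b + C) ≡ (1ℚ + k) * (a * b) + (C + k * C)
  lem₁ = solve-∀ ring
  lem₂ : ∀ k a b C D E → k * (a * b) + (C + (D + E)) ≡ (0ℚ * a * b + (C + D)) + (a * (k * b) + E)
  lem₂ = solve-∀ ring

⋆-congʳ-≤ : ∀ f {g g′} n → (∀ i → i ≤ n → g i ≡ g′ i) → (f ⋆ g) n ≡ (f ⋆ g′) n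
⋆-congʳ-≤ f n g≡g′ = ∑-cong {suc n} λ i → cong (_*_ (f (toℕ i))) (g≡g′ (n ∸ toℕ i) (ℕ.m∸n≤m n (toℕ i)))

-- The only term that sees `g n` has the factor `f 0`.
⋆-congʳ-< : ∀ f {g g′} n → f 0 ≡ 0ℚ → (∀ i → i < n → g i ≡ g′ i) → (f ⋆ g) n ≡ (f ⋆ g′) n
⋆-congʳ-< f {g} {g′} n f0≡0 g≡g′ = cong₂ _+_ head (tail n g≡g′)
  where
  head : f 0 * g n ≡ f 0 * g′ n
  head = begin-equality
    f 0 * g n   ≡⟨ cong (_* g n) f0≡0 ⟩
    0ℚ * g n    ≡⟨ trans (ℚ.*-zeroˡ (g n)) (sym (ℚ.*-zeroˡ (g′ n))) ⟩
    0ℚ * g′ n   ≡⟨ cong (_* g′ n) f0≡0 ⟨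
    f 0 * g′ n  ∎
  tail : ∀ n → (∀ i → i < n → g i ≡ g′ i) →
    ∑ {n} (λ i → f (suc (toℕ i)) * g (n ∸ suc (toℕ i))) ≡
    ∑ {n} (λ i → f (suc (toℕ i)) * g′ (n ∸ suc (toℕ i)))
  tail zero    _    = refl
  tail (suc n) g≡g′ = ⋆-congʳ-≤ (f ∘ suc) n λ i i≤n → g≡g′ i (s≤s i≤n)

-- Bivariate series and uniqueness of the quotient

-- A factor free of y contributes only at j = 0, which leaves a Cauchy product in the first index
-- with the second one fixed.
inX-*ₛ : ∀ f Q m n → (inX f *ₛ Q) m n ≡ (f ⋆ λ i → Q i n) m
inX-*ₛ f Q m n = ∑-cong {suc m} {y = λ i → f (toℕ i) * Q (m ∸ toℕ i) n} λ i → trans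
  (cong (_+_ (f (toℕ i) * Q (m ∸ toℕ i) n)) (∑-0* n λ j → Q (m ∸ toℕ i) (n ∸ suc (toℕ j))))
  (ℚ.+-identityʳ (f (toℕ i) * Q (m ∸ toℕ i) n))

inY-*ₛ : ∀ g Q m n → (inY g *ₛ Q) m n ≡ (g ⋆ Q m) n
inY-*ₛ g Q m n = trans
  (cong (_+_ ((g ⋆ Q m) n))
    (trans
      (∑-cong {m} λ i → ∑-0* (suc n) λ j → Q (m ∸ suc (toℕ i)) (n ∸ toℕ j))
      (∑-zero m)))
  (ℚ.+-identityʳ ((g ⋆ Q m) n))

-ₛ-*ₛ : ∀ F G Q m n → ((F -ₛ G) *ₛ Q) m n ≡ (F *ₛ Q) m n - (G *ₛ Q) m n
-ₛ-*ₛ F G Q m n = trans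
  (∑-cong {suc m} λ i → trans
    (∑-cong {suc n} λ j → lem (F (toℕ i) (toℕ j)) (G (toℕ i) (toℕ j)) (Q (m ∸ toℕ i) (n ∸ toℕ j)))
    (∑-minus {suc n} (F* i) (G* i)))
  (∑-minus {suc m} (λ i → ∑ {suc n} (F* i)) (λ i → ∑ {suc n} (G* i)))
  where
  F* G* : Fin (suc m) → Fin (suc n) → ℚ
  F* i j = F (toℕ i) (toℕ j) * Q (m ∸ toℕ i) (n ∸ toℕ j)
  G* i j = G (toℕ i) (toℕ j) * Q (m ∸ toℕ i) (n ∸ toℕ j)
  lem : ∀ a b c → (a - b) * c ≡ a * c - b * c
  lem = solve-∀ ring

L : ℕ → ℚ
L = log1+

logX-logY : Series
logX-logY = inX L -ₛ inY L

logX-logY-*ₛ : ∀ Q m n → (logX-logY *ₛ Q) m n ≡ (L ⋆ λ i → Q i n) m - (L ⋆ Q m) n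
logX-logY-*ₛ Q m n = trans (-ₛ-*ₛ (inX L) (inY L) Q m n) (cong₂ _-_ (inX-*ₛ L Q m n) (inY-*ₛ L Q m n))

-- The coefficient of Q m n in D *ₛ Q at (m + 1, n) is 1, and all other terms there
-- come lexicographically before (n, m).
quotient-unique : ∀ N Q Q′ → Q IsQuotient N Over logX-logY → Q′ IsQuotient N Over logX-logY →
  Q ≈ₛ Q′
quotient-unique N Q Q′ DQ≈N DQ′≈N m n =
  -- The hypothesis on earlier columns must cover all rows, since the equation at (m + 1, n)
  -- involves row m + 1, beyond the current one.
  <-rec (λ n → ∀ m → Q m n ≡ Q′ m n) (λ n earlierColumns →
    <-rec (λ m → Q m n ≡ Q′ m n) (λ m earlierRows →
      step m n (λ i i<m → earlierRows i<m) (λ j j<n → earlierColumns j<n (suc m)))) n m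
  where
  -- The series log(1+t)/t - 1. Its constant term is 0, which keeps `Q m n` itself out of the
  -- remaining convolution.
  L° : ℕ → ℚ
  L° i = L (suc i) - δ i

  L⋆-suc : ∀ g m → (L ⋆ g) (suc m) ≡ g m + (L° ⋆ g) m
  L⋆-suc g m = begin-equality
    0ℚ * g (suc m) + ((L ∘ suc) ⋆ g) m
      ≡⟨ cong₂ _+_ (ℚ.*-zeroˡ (g (suc m))) (⋆-cong {g = g} (λ i → lem (L (suc i)) (δ i)) (λ _ → refl) m) ⟩
    0ℚ + ((λ i → δ i + L° i) ⋆ g) m  ≡⟨ ℚ.+-identityˡ (((λ i → δ i + L° i) ⋆ g) m) ⟩
    ((λ i → δ i + L° i) ⋆ g) m       ≡⟨ ⋆-+ˡ δ L° g m ⟩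
    (δ ⋆ g) m + (L° ⋆ g) m           ≡⟨ cong (_+ (L° ⋆ g) m) (δ⋆ g m) ⟩
    g m + (L° ⋆ g) m                 ∎
    where
    lem : ∀ a b → a ≡ b + (a - b)
    lem = solve-∀ ring

  D-suc : ∀ Q m n → (logX-logY *ₛ Q) (suc m) n ≡ (Q m n + (L° ⋆ λ i → Q i n) m) - (L ⋆ Q (suc m)) n
  D-suc Q m n = trans (logX-logY-*ₛ Q (suc m) n) (cong (_- (L ⋆ Q (suc m)) n) (L⋆-suc (λ i → Q i n) m))

  step : ∀ m n → (∀ i → i < m → Q i n ≡ Q′ i n) → (∀ j → j < n → Q (suc m) j ≡ Q′ (suc m) j) →
    Q m n ≡ Q′ m n
  step m n rows columns = begin-equality
    Q m n                                      ≡⟨ isolate (Q m n) ((L° ⋆ λ i → Q i n) m) ((L ⋆ Q (suc m)) n) ⟩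
    ((Q m n + (L° ⋆ λ i → Q i n) m) - (L ⋆ Q (suc m)) n) - (L° ⋆ λ i → Q i n) m + (L ⋆ Q (suc m)) n
      ≡⟨ cong₂ _+_ (cong₂ _-_ same (⋆-congʳ-< L° m refl rows)) (⋆-congʳ-< L n refl columns) ⟩
    ((Q′ m n + (L° ⋆ λ i → Q′ i n) m) - (L ⋆ Q′ (suc m)) n) - (L° ⋆ λ i → Q′ i n) m + (L ⋆ Q′ (suc m)) n
      ≡⟨ isolate (Q′ m n) ((L° ⋆ λ i → Q′ i n) m) ((L ⋆ Q′ (suc m)) n) ⟨
    Q′ m n ∎
    where
    same = trans (sym (D-suc Q m n)) (trans (trans (DQ≈N (suc m) n) (sym (DQ′≈N (suc m) n))) (D-suc Q′ m n))
    isolate : ∀ q a b → q ≡ ((q + a) - b) - a + b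
    isolate = solve-∀ ring

-- Polynomials with rational coefficients

⟦_⟧ : Poly → ℚ → ℚ
⟦ []    ⟧ t = 0ℚ
⟦ a ∷ p ⟧ t = a + t * ⟦ p ⟧ t

infix 4 _≗ₚ_

_≗ₚ_ : Poly → Poly → Set
p ≗ₚ q = ⟦ p ⟧ ≗ ⟦ q ⟧

scale : ℚ → Poly → Poly
scale c = map (c *_)

⟦add⟧ : ∀ p q t → ⟦ add p q ⟧ t ≡ ⟦ p ⟧ t + ⟦ q ⟧ t
⟦add⟧ []      q       t = sym (ℚ.+-identityˡ (⟦ q ⟧ t))
⟦add⟧ (a ∷ p) []      t = sym (ℚ.+-identityʳ (⟦ a ∷ p ⟧ t))
⟦add⟧ (a ∷ p) (b ∷ q) t = trans
  (cong (λ v → a + b + t * v) (⟦add⟧ p q t))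
  (lem a b t (⟦ p ⟧ t) (⟦ q ⟧ t))
  where
  lem : ∀ a b t x y → a + b + t * (x + y) ≡ (a + t * x) + (b + t * y)
  lem = solve-∀ ring

⟦scale⟧ : ∀ c p t → ⟦ scale c p ⟧ t ≡ c * ⟦ p ⟧ t
⟦scale⟧ c []      t = sym (ℚ.*-zeroʳ c)
⟦scale⟧ c (a ∷ p) t = trans (cong (λ v → c * a + t * v) (⟦scale⟧ c p t)) (lem c a t (⟦ p ⟧ t))
  where
  lem : ∀ c a t x → c * a + t * (c * x) ≡ c * (a + t * x)
  lem = solve-∀ ring

⟦mul⟧ : ∀ p q t → ⟦ mul p q ⟧ t ≡ ⟦ p ⟧ t * ⟦ q ⟧ t
⟦mul⟧ []      q t = sym (ℚ.*-zeroˡ (⟦ q ⟧ t))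
⟦mul⟧ (a ∷ p) q t = begin-equality
  ⟦ add (scale a q) (0ℚ ∷ mul p q) ⟧ t
    ≡⟨ ⟦add⟧ (scale a q) (0ℚ ∷ mul p q) t ⟩
  ⟦ scale a q ⟧ t + (0ℚ + t * ⟦ mul p q ⟧ t)
    ≡⟨ cong₂ (λ u v → u + (0ℚ + t * v)) (⟦scale⟧ a q t) (⟦mul⟧ p q t) ⟩
  a * ⟦ q ⟧ t + (0ℚ + t * (⟦ p ⟧ t * ⟦ q ⟧ t))
    ≡⟨ lem a t (⟦ p ⟧ t) (⟦ q ⟧ t) ⟩
  (a + t * ⟦ p ⟧ t) * ⟦ q ⟧ t ∎
  where
  lem : ∀ a t x y → a * y + (0ℚ + t * (x * y)) ≡ (a + t * x) * y
  lem = solve-∀ ring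

-- With a shift of the list this covers derivative and antiderivative alike, whose weights i + 1 and
-- 1/(i + 1) are mutually inverse.
weigh : (ℕ → ℚ) → Poly → Poly
weigh w []      = []
weigh w (a ∷ p) = w 0 * a ∷ weigh (w ∘ suc) p

weigh-add : ∀ w p q → weigh w (add p q) ≡ add (weigh w p) (weigh w q)
weigh-add w []      q       = refl
weigh-add w (a ∷ p) []      = refl
weigh-add w (a ∷ p) (b ∷ q) = cong₂ _∷_ (ℚ.*-distribˡ-+ (w 0) a b) (weigh-add (w ∘ suc) p q)

weigh-scale : ∀ w c p → weigh w (scale c p) ≡ scale c (weigh w p)
weigh-scale w c []      = refl
weigh-scale w c (a ∷ p) = cong₂ _∷_ (lem (w 0) c a) (weigh-scale (w ∘ suc) c p)
  where
  lem : ∀ w c a → w * (c * a) ≡ c * (w * a)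
  lem = solve-∀ ring

weigh-inverse : ∀ {v w} → (∀ i → v i * w i ≡ 1ℚ) → ∀ p → weigh v (weigh w p) ≡ p
weigh-inverse vw≡1 []      = refl
weigh-inverse {v} {w} vw≡1 (a ∷ p) = cong₂ _∷_
  (begin-equality
    v 0 * (w 0 * a)  ≡⟨ ℚ.*-assoc (v 0) (w 0) a ⟨
    (v 0 * w 0) * a  ≡⟨ cong (_* a) (vw≡1 0) ⟩
    1ℚ * a           ≡⟨ ℚ.*-identityˡ a ⟩
    a                ∎)
  (weigh-inverse (vw≡1 ∘ suc) p)

-- Compares the weights i + 2 and i + 1 that the tail of a list receives when it is differentiated
-- behind two leading coefficients or behind one.
⟦weigh-suc⟧ : ∀ {v w} → (∀ i → v i ≡ 1ℚ + w i) → ∀ p t → ⟦ weigh v p ⟧ t ≡ ⟦ p ⟧ t + ⟦ weigh w p ⟧ t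
⟦weigh-suc⟧ v≡1+w []      t = refl
⟦weigh-suc⟧ {v} {w} v≡1+w (a ∷ p) t = begin-equality
  v 0 * a + t * ⟦ weigh (v ∘ suc) p ⟧ t
    ≡⟨ cong₂ (λ k x → k * a + t * x) (v≡1+w 0) (⟦weigh-suc⟧ (v≡1+w ∘ suc) p t) ⟩
  (1ℚ + w 0) * a + t * (⟦ p ⟧ t + ⟦ weigh (w ∘ suc) p ⟧ t)
    ≡⟨ lem (w 0) a t (⟦ p ⟧ t) (⟦ weigh (w ∘ suc) p ⟧ t) ⟩
  (a + t * ⟦ p ⟧ t) + (w 0 * a + t * ⟦ weigh (w ∘ suc) p ⟧ t) ∎
  where
  lem : ∀ w a t x y → (1ℚ + w) * a + t * (x + y) ≡ (a + t * x) + (w * a + t * y)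
  lem = solve-∀ ring

reciprocal : ℕ → ℚ
reciprocal i = + 1 / suc i

deriv : Poly → Poly
deriv []      = []
deriv (a ∷ p) = weigh (ι ∘ suc) p

antideriv : Poly → Poly
antideriv p = 0ℚ ∷ weigh reciprocal p

-- The sum of the a_i / (i + 1), a definition without limits; `polynomial-hasIntegral` ties it to
-- Riemann sums.
∫₀¹ : Poly → ℚ
∫₀¹ p = ⟦ weigh reciprocal p ⟧ 1ℚ

deriv-antideriv : ∀ p → deriv (antideriv p) ≡ p
deriv-antideriv = weigh-inverse λ i →
  trans (ℚ.*-comm (ι (suc i)) (reciprocal i)) (/-*-cancel (+ 1) (suc i))

∫₀¹-deriv : ∀ p → ∫₀¹ (deriv p) ≡ ⟦ p ⟧ 1ℚ - ⟦ p ⟧ 0ℚ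
∫₀¹-deriv []      = refl
∫₀¹-deriv (a ∷ p) = trans
  (cong (λ q → ⟦ q ⟧ 1ℚ) (weigh-inverse (λ i → /-*-cancel (+ 1) (suc i)) p))
  (lem a (⟦ p ⟧ 1ℚ) (⟦ p ⟧ 0ℚ))
  where
  lem : ∀ a x y → x ≡ (a + 1ℚ * x) - (a + 0ℚ * y)
  lem = solve-∀ ring

⟦deriv-∷⟧ : ∀ a p t → ⟦ deriv (a ∷ p) ⟧ t ≡ ⟦ p ⟧ t + t * ⟦ deriv p ⟧ t
⟦deriv-∷⟧ a []      t = sym (trans (ℚ.+-identityˡ (t * 0ℚ)) (ℚ.*-zeroʳ t))
⟦deriv-∷⟧ a (b ∷ p) t = trans
  (cong (λ x → 1ℚ * b + t * x) (⟦weigh-suc⟧ (ι-suc ∘ suc) p t))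
  (lem b t (⟦ p ⟧ t) (⟦ weigh (ι ∘ suc) p ⟧ t))
  where
  lem : ∀ b t x y → 1ℚ * b + t * (x + y) ≡ (b + t * x) + t * y
  lem = solve-∀ ring

deriv-add : ∀ p q → deriv (add p q) ≡ add (deriv p) (deriv q)
deriv-add []      q       = refl
deriv-add (a ∷ [])    []  = refl
deriv-add (a ∷ b ∷ p) []  = refl
deriv-add (a ∷ p) (b ∷ q) = weigh-add (ι ∘ suc) p q

deriv-scale : ∀ c p → deriv (scale c p) ≡ scale c (deriv p)
deriv-scale c []      = refl
deriv-scale c (a ∷ p) = weigh-scale (ι ∘ suc) c p

-- The rule is about values because the lists on the two sides may differ by trailing zeros.
⟦deriv-mul⟧ : ∀ p q t →
  ⟦ deriv (mul p q) ⟧ t ≡ ⟦ deriv p ⟧ t * ⟦ q ⟧ t + ⟦ p ⟧ t * ⟦ deriv q ⟧ t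
⟦deriv-mul⟧ []      q t = lem (⟦ q ⟧ t) (⟦ deriv q ⟧ t)
  where
  lem : ∀ x y → 0ℚ ≡ 0ℚ * x + 0ℚ * y
  lem = solve-∀ ring
⟦deriv-mul⟧ (a ∷ p) q t = begin-equality
  ⟦ deriv (add (scale a q) (0ℚ ∷ mul p q)) ⟧ t
    ≡⟨ cong (λ r → ⟦ r ⟧ t) (deriv-add (scale a q) (0ℚ ∷ mul p q)) ⟩
  ⟦ add (deriv (scale a q)) (deriv (0ℚ ∷ mul p q)) ⟧ t
    ≡⟨ ⟦add⟧ (deriv (scale a q)) (deriv (0ℚ ∷ mul p q)) t ⟩
  ⟦ deriv (scale a q) ⟧ t + ⟦ deriv (0ℚ ∷ mul p q) ⟧ t
    ≡⟨ cong₂ _+_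
         (trans (cong (λ r → ⟦ r ⟧ t) (deriv-scale a q)) (⟦scale⟧ a (deriv q) t))
         (⟦deriv-∷⟧ 0ℚ (mul p q) t) ⟩
  a * ⟦ deriv q ⟧ t + (⟦ mul p q ⟧ t + t * ⟦ deriv (mul p q) ⟧ t)
    ≡⟨ cong₂ (λ x y → a * ⟦ deriv q ⟧ t + (x + t * y)) (⟦mul⟧ p q t) (⟦deriv-mul⟧ p q t) ⟩
  a * q′ + (⟦ p ⟧ t * ⟦ q ⟧ t + t * (p′ * ⟦ q ⟧ t + ⟦ p ⟧ t * q′))
    ≡⟨ lem a t (⟦ p ⟧ t) p′ (⟦ q ⟧ t) q′ ⟩
  (⟦ p ⟧ t + t * p′) * ⟦ q ⟧ t + (a + t * ⟦ p ⟧ t) * q′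
    ≡⟨ cong (λ x → x * ⟦ q ⟧ t + ⟦ a ∷ p ⟧ t * q′) (⟦deriv-∷⟧ a p t) ⟨
  ⟦ deriv (a ∷ p) ⟧ t * ⟦ q ⟧ t + ⟦ a ∷ p ⟧ t * q′ ∎
  where
  p′ = ⟦ deriv p ⟧ t
  q′ = ⟦ deriv q ⟧ t
  lem : ∀ a t x x′ y y′ →
    a * y′ + (x * y + t * (x′ * y + x * y′)) ≡ (x + t * x′) * y + (a + t * x) * y′
  lem = solve-∀ ring

-- Bounds on [0,1] and vanishing polynomials

*-monoˡ : ∀ {x y z} → 0ℚ ℚ.≤ x → y ℚ.≤ z → x * y ℚ.≤ x * z
*-monoˡ {x} 0≤x = ℚ.*-monoˡ-≤-nonNeg x {{ℚ.nonNegative 0≤x}}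

*-monoʳ : ∀ {x y z} → 0ℚ ℚ.≤ x → y ℚ.≤ z → y * x ℚ.≤ z * x
*-monoʳ {x} 0≤x = ℚ.*-monoʳ-≤-nonNeg x {{ℚ.nonNegative 0≤x}}

∣t*x∣≤∣x∣ : ∀ {t} x → 0ℚ ℚ.≤ t → t ℚ.≤ 1ℚ → ∣ t * x ∣ ℚ.≤ ∣ x ∣
∣t*x∣≤∣x∣ {t} x 0≤t t≤1 = begin
  ∣ t * x ∣      ≡⟨ ℚ.∣p*q∣≡∣p∣*∣q∣ t x ⟩
  ∣ t ∣ * ∣ x ∣  ≡⟨ cong (_* ∣ x ∣) (ℚ.0≤p⇒∣p∣≡p 0≤t) ⟩
  t * ∣ x ∣      ≤⟨ *-monoʳ (ℚ.0≤∣p∣ x) t≤1 ⟩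
  1ℚ * ∣ x ∣     ≡⟨ ℚ.*-identityˡ ∣ x ∣ ⟩
  ∣ x ∣          ∎

0≤+ : ∀ {x y} → 0ℚ ℚ.≤ x → 0ℚ ℚ.≤ y → 0ℚ ℚ.≤ x + y
0≤+ = ℚ.+-mono-≤

bounded : ∀ p → ∃ λ M → 0ℚ ℚ.≤ M × (∀ {t} → 0ℚ ℚ.≤ t → t ℚ.≤ 1ℚ → ∣ ⟦ p ⟧ t ∣ ℚ.≤ M)
bounded []      = 0ℚ , ℚ.≤-refl , λ _ _ → ℚ.≤-refl
bounded (a ∷ p) with M , 0≤M , ∣p∣≤M ← bounded p =
  ∣ a ∣ + M , 0≤+ (ℚ.0≤∣p∣ a) 0≤M , λ {t} 0≤t t≤1 → begin
    ∣ a + t * ⟦ p ⟧ t ∣      ≤⟨ ℚ.∣p+q∣≤∣p∣+∣q∣ a (t * ⟦ p ⟧ t) ⟩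
    ∣ a ∣ + ∣ t * ⟦ p ⟧ t ∣  ≤⟨ ℚ.+-monoʳ-≤ ∣ a ∣ (ℚ.≤-trans (∣t*x∣≤∣x∣ (⟦ p ⟧ t) 0≤t t≤1) (∣p∣≤M 0≤t t≤1)) ⟩
    ∣ a ∣ + M                ∎

-- For 0 < t ≤ 1 the equation a + t p(t) = 0 gives ∣a∣ ≤ t M, where M bounds p on [0,1];
-- this fails at t = ∣a∣ / (∣a∣ + M) unless a = 0.
vanishing⇒zero : ∀ p → (∀ {t} → 0ℚ ℚ.< t → t ℚ.≤ 1ℚ → ⟦ p ⟧ t ≡ 0ℚ) → All (_≡ 0ℚ) p
vanishing⇒zero []      _    = []
vanishing⇒zero (a ∷ p) zero-on with a ℚ.≟ 0ℚ
... | yes refl = refl ∷ vanishing⇒zero p λ {t} 0<t t≤1 →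
  cancel t 0<t (trans (sym (ℚ.+-identityˡ (t * ⟦ p ⟧ t))) (zero-on 0<t t≤1))
  where
  cancel : ∀ t → 0ℚ ℚ.< t → ∀ {x} → t * x ≡ 0ℚ → x ≡ 0ℚ
  cancel t 0<t {x} tx≡0 = begin-equality
    x                       ≡⟨ ℚ.*-identityˡ x ⟨
    1ℚ * x                  ≡⟨ cong (_* x) (ℚ.*-inverseˡ t) ⟨
    (ℚ.1/ t) * t * x        ≡⟨ ℚ.*-assoc (ℚ.1/ t) t x ⟩
    (ℚ.1/ t) * (t * x)      ≡⟨ cong ((ℚ.1/ t) *_) tx≡0 ⟩
    (ℚ.1/ t) * 0ℚ           ≡⟨ ℚ.*-zeroʳ (ℚ.1/ t) ⟩
    0ℚ                      ∎
    where instance _ = ℚ.>-nonZero 0<t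
... | no a≢0 = ⊥-elim (ℚ.<-irrefl refl (begin-strict
    α                ≡⟨ ∣a∣≡ ⟩
    ∣ t * ⟦ p ⟧ t ∣  ≡⟨ trans (ℚ.∣p*q∣≡∣p∣*∣q∣ t (⟦ p ⟧ t)) (cong (_* ∣ ⟦ p ⟧ t ∣) (ℚ.0≤p⇒∣p∣≡p (ℚ.<⇒≤ 0<t))) ⟩
    t * ∣ ⟦ p ⟧ t ∣  ≤⟨ *-monoˡ (ℚ.<⇒≤ 0<t) (proj₂ (proj₂ (bounded p)) (ℚ.<⇒≤ 0<t) t≤1) ⟩
    t * M            <⟨ ℚ.*-monoʳ-<-pos t M<K ⟩
    t * K            ≡⟨ tK≡α ⟩
    α                ∎))
  where
  α = ∣ a ∣
  M = proj₁ (bounded p)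
  K = α + M
  0≤M : 0ℚ ℚ.≤ M
  0≤M = proj₁ (proj₂ (bounded p))
  0<α : 0ℚ ℚ.< α
  0<α = ℚ.≰⇒> λ α≤0 → a≢0 (ℚ.∣p∣≡0⇒p≡0 a (ℚ.≤-antisym α≤0 (ℚ.0≤∣p∣ a)))
  α≤K : α ℚ.≤ K
  α≤K = ℚ.≤-trans (ℚ.≤-reflexive (sym (ℚ.+-identityʳ α))) (ℚ.+-monoʳ-≤ α 0≤M)
  M<K : M ℚ.< K
  M<K = ℚ.≤-<-trans (ℚ.≤-reflexive (sym (ℚ.+-identityˡ M))) (ℚ.+-monoˡ-< M 0<α)
  0<K : 0ℚ ℚ.< K
  0<K = ℚ.<-≤-trans 0<α α≤K
  instance
    K-positive : ℚ.Positive K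
    K-positive = ℚ.positive 0<K
    K-nonZero : ℚ.NonZero K
    K-nonZero = ℚ.>-nonZero 0<K
    α-positive : ℚ.Positive α
    α-positive = ℚ.positive 0<α
    1/K-positive : ℚ.Positive (ℚ.1/ K)
    1/K-positive = ℚ.1/pos⇒pos K
  t = α * ℚ.1/ K
  instance
    t-positive : ℚ.Positive t
    t-positive = ℚ.pos*pos⇒pos α (ℚ.1/ K)
  0<t : 0ℚ ℚ.< t
  0<t = ℚ.positive⁻¹ t
  t≤1 : t ℚ.≤ 1ℚ
  t≤1 = begin
    α * ℚ.1/ K  ≤⟨ *-monoʳ (ℚ.<⇒≤ (ℚ.positive⁻¹ (ℚ.1/ K))) α≤K ⟩
    K * ℚ.1/ K  ≡⟨ ℚ.*-inverseʳ K ⟩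
    1ℚ          ∎
  tK≡α : t * K ≡ α
  tK≡α = trans (ℚ.*-assoc α (ℚ.1/ K) K) (trans (cong (α *_) (ℚ.*-inverseˡ K)) (ℚ.*-identityʳ α))
  ∣a∣≡ : α ≡ ∣ t * ⟦ p ⟧ t ∣
  ∣a∣≡ = trans (cong ∣_∣ (lem a (t * ⟦ p ⟧ t) (zero-on 0<t t≤1))) (ℚ.∣-p∣≡∣p∣ (t * ⟦ p ⟧ t))
    where
    rearrange : ∀ x y → x ≡ (x + y) + - y
    rearrange = solve-∀ ring
    lem : ∀ x y → x + y ≡ 0ℚ → x ≡ - y
    lem x y x+y≡0 = trans (rearrange x y) (trans (cong (_+ - y) x+y≡0) (ℚ.+-identityˡ (- y)))

-- Linear functionals see a polynomial only through its values (linear-ext), which lets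
-- identities between polynomials be proved pointwise.
record Linear (φ : Poly → ℚ) : Set where
  field
    add-homo   : ∀ p q → φ (add p q) ≡ φ p + φ q
    scale-homo : ∀ c p → φ (scale c p) ≡ c * φ p

open Linear

linear-[] : ∀ {φ} → Linear φ → φ [] ≡ 0ℚ
linear-[] {φ} lin = trans (scale-homo lin 0ℚ []) (ℚ.*-zeroˡ (φ []))

-- Absorbing a leading zero into the functional lets `linear-zero` recurse on the list while the
-- functional varies.
0∷-linear : ∀ {φ} → Linear φ → Linear (λ p → φ (0ℚ ∷ p))
0∷-linear {φ} lin = record
  { add-homo   = λ p q → add-homo lin (0ℚ ∷ p) (0ℚ ∷ q)
  ; scale-homo = λ c p → trans
      (cong (λ z → φ (z ∷ scale c p)) (sym (ℚ.*-zeroʳ c)))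
      (scale-homo lin c (0ℚ ∷ p))
  }

linear-zero : ∀ {φ} → Linear φ → ∀ {p} → All (_≡ 0ℚ) p → φ p ≡ 0ℚ
linear-zero lin []           = linear-[] lin
linear-zero lin (refl ∷ p≡0) = linear-zero (0∷-linear lin) p≡0

-- The difference of the two lists vanishes everywhere, so all its entries are 0 although it need
-- not be empty; linearity sends every list of zeros to 0.
linear-ext : ∀ {φ} → Linear φ → ∀ p q → p ≗ₚ q → φ p ≡ φ q
linear-ext {φ} lin p q p≗q = begin-equality
  φ p                            ≡⟨ lem (φ p) (φ q) ⟩
  (φ p + - 1ℚ * φ q) + φ q       ≡⟨ cong (λ x → (φ p + x) + φ q) (scale-homo lin (- 1ℚ) q) ⟨
  (φ p + φ (scale (- 1ℚ) q)) + φ q  ≡⟨ cong (_+ φ q) (add-homo lin p (scale (- 1ℚ) q)) ⟨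
  φ d + φ q                      ≡⟨ cong (_+ φ q) (linear-zero lin (vanishing⇒zero d λ {t} _ _ → d≡0 t)) ⟩
  0ℚ + φ q                       ≡⟨ ℚ.+-identityˡ (φ q) ⟩
  φ q                            ∎
  where
  d = add p (scale (- 1ℚ) q)
  lem : ∀ x y → x ≡ (x + - 1ℚ * y) + y
  lem = solve-∀ ring
  lem′ : ∀ x → x + - 1ℚ * x ≡ 0ℚ
  lem′ = solve-∀ ring
  d≡0 : ∀ t → ⟦ d ⟧ t ≡ 0ℚ
  d≡0 t = trans (⟦add⟧ p (scale (- 1ℚ) q) t)
    (trans (cong₂ _+_ (p≗q t) (⟦scale⟧ (- 1ℚ) q t)) (lem′ (⟦ q ⟧ t)))

⟦⟧-linear : ∀ t → Linear (λ p → ⟦ p ⟧ t)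
⟦⟧-linear t = record { add-homo = λ p q → ⟦add⟧ p q t ; scale-homo = λ c p → ⟦scale⟧ c p t }

∫₀¹-linear : Linear ∫₀¹
∫₀¹-linear = record
  { add-homo   = λ p q → trans (cong (λ r → ⟦ r ⟧ 1ℚ) (weigh-add reciprocal p q))
      (⟦add⟧ (weigh reciprocal p) (weigh reciprocal q) 1ℚ)
  ; scale-homo = λ c p → trans (cong (λ r → ⟦ r ⟧ 1ℚ) (weigh-scale reciprocal c p))
      (⟦scale⟧ c (weigh reciprocal p) 1ℚ)
  }

∘deriv-linear : ∀ {φ} → Linear φ → Linear (φ ∘ deriv)
∘deriv-linear {φ} lin = record
  { add-homo   = λ p q → trans (cong φ (deriv-add p q)) (add-homo lin (deriv p) (deriv q))
  ; scale-homo = λ c p → trans (cong φ (deriv-scale c p)) (scale-homo lin c (deriv p))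
  }

∘mulˡ-linear : ∀ {φ} → Linear φ → ∀ r → Linear (λ p → φ (mul r p))
∘mulˡ-linear {φ} lin r = record
  { add-homo   = λ p q → trans
      (linear-ext lin (mul r (add p q)) (add (mul r p) (mul r q)) λ t → trans (⟦mul⟧ r (add p q) t)
        (trans (cong (⟦ r ⟧ t *_) (⟦add⟧ p q t))
        (trans (ℚ.*-distribˡ-+ (⟦ r ⟧ t) (⟦ p ⟧ t) (⟦ q ⟧ t))
        (sym (trans (⟦add⟧ (mul r p) (mul r q) t) (cong₂ _+_ (⟦mul⟧ r p t) (⟦mul⟧ r q t)))))))
      (add-homo lin (mul r p) (mul r q))
  ; scale-homo = λ c p → trans
      (linear-ext lin (mul r (scale c p)) (scale c (mul r p)) λ t → trans (⟦mul⟧ r (scale c p) t)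
        (trans (cong (⟦ r ⟧ t *_) (⟦scale⟧ c p t))
        (trans (lem (⟦ r ⟧ t) c (⟦ p ⟧ t))
        (sym (trans (⟦scale⟧ c (mul r p) t) (cong (c *_) (⟦mul⟧ r p t)))))))
      (scale-homo lin c (mul r p))
  }
  where
  lem : ∀ r c p → r * (c * p) ≡ c * (r * p)
  lem = solve-∀ ring

mul-comm : ∀ p q → mul p q ≗ₚ mul q p
mul-comm p q t = trans (⟦mul⟧ p q t) (trans (ℚ.*-comm (⟦ p ⟧ t) (⟦ q ⟧ t)) (sym (⟦mul⟧ q p t)))

∘mulʳ-linear : ∀ {φ} → Linear φ → ∀ r → Linear (λ p → φ (mul p r))
∘mulʳ-linear {φ} lin r = record
  { add-homo   = λ p q → trans (comm (add p q)) (trans (add-homo rφ p q) (sym (cong₂ _+_ (comm p) (comm q))))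
  ; scale-homo = λ c p → trans (comm (scale c p)) (trans (scale-homo rφ c p) (sym (cong (c *_) (comm p))))
  }
  where
  rφ = ∘mulˡ-linear lin r
  comm : ∀ p → φ (mul p r) ≡ φ (mul r p)
  comm p = linear-ext lin (mul p r) (mul r p) (mul-comm p r)

infixl 7 _⋆ₚ_

-- The Cauchy product of scalars with polynomials, needed as an actual polynomial so that a linear
-- functional can be applied to it and moved inside.
_⋆ₚ_ : (ℕ → ℚ) → (ℕ → Poly) → ℕ → Poly
(f ⋆ₚ g) zero    = scale (f 0) (g 0)
(f ⋆ₚ g) (suc n) = add (scale (f 0) (g (suc n))) (((f ∘ suc) ⋆ₚ g) n)

linear-⋆ₚ : ∀ {φ} → Linear φ → ∀ f g n → φ ((f ⋆ₚ g) n) ≡ (f ⋆ (φ ∘ g)) n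
linear-⋆ₚ {φ} lin f g zero    = trans (scale-homo lin (f 0) (g 0)) (sym (ℚ.+-identityʳ (f 0 * φ (g 0))))
linear-⋆ₚ {φ} lin f g (suc n) = trans
  (add-homo lin (scale (f 0) (g (suc n))) (((f ∘ suc) ⋆ₚ g) n))
  (cong₂ _+_ (scale-homo lin (f 0) (g (suc n))) (linear-⋆ₚ lin (f ∘ suc) g n))

∫₀¹-by-parts : ∀ p q →
  ∫₀¹ (mul (deriv p) q) + ∫₀¹ (mul p (deriv q)) ≡ ⟦ p ⟧ 1ℚ * ⟦ q ⟧ 1ℚ - ⟦ p ⟧ 0ℚ * ⟦ q ⟧ 0ℚ
∫₀¹-by-parts p q = begin-equality
  ∫₀¹ (mul (deriv p) q) + ∫₀¹ (mul p (deriv q))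
    ≡⟨ add-homo ∫₀¹-linear (mul (deriv p) q) (mul p (deriv q)) ⟨
  ∫₀¹ (add (mul (deriv p) q) (mul p (deriv q)))
    ≡⟨ linear-ext ∫₀¹-linear (add (mul (deriv p) q) (mul p (deriv q))) (deriv (mul p q)) (λ t →
         trans (⟦add⟧ (mul (deriv p) q) (mul p (deriv q)) t)
         (trans (cong₂ _+_ (⟦mul⟧ (deriv p) q t) (⟦mul⟧ p (deriv q) t)) (sym (⟦deriv-mul⟧ p q t)))) ⟩
  ∫₀¹ (deriv (mul p q))
    ≡⟨ ∫₀¹-deriv (mul p q) ⟩
  ⟦ mul p q ⟧ 1ℚ - ⟦ mul p q ⟧ 0ℚ
    ≡⟨ cong₂ _-_ (⟦mul⟧ p q 1ℚ) (⟦mul⟧ p q 0ℚ) ⟩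
  ⟦ p ⟧ 1ℚ * ⟦ q ⟧ 1ℚ - ⟦ p ⟧ 0ℚ * ⟦ q ⟧ 0ℚ ∎

-- Binomial polynomials

-- (1 + t) d/dt log(1 + t) = 1.
θL-rec : ∀ i → θ L (suc i) + θ L i ≡ δ i
θL-rec zero    = refl
θL-rec (suc k) = begin-equality
  θ L (suc (suc k)) + θ L (suc k)
    ≡⟨ cong₂ _+_ (θL-suc (suc k)) (θL-suc k) ⟩
  (-1ℤ ℤ.^ suc k) / 1 + (-1ℤ ℤ.^ k) / 1
    ≡⟨ /1-homo-+ (-1ℤ ℤ.^ suc k) (-1ℤ ℤ.^ k) ⟨
  (-1ℤ ℤ.* -1ℤ ℤ.^ k ℤ.+ -1ℤ ℤ.^ k) / 1
    ≡⟨ cong (_/ 1) (trans (cong (ℤ._+ (-1ℤ ℤ.^ k)) (ℤ.-1*i≡-i (-1ℤ ℤ.^ k))) (ℤ.+-inverseˡ (-1ℤ ℤ.^ k))) ⟩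
  0ℚ ∎
  where
  θL-suc : ∀ k → θ L (suc k) ≡ (-1ℤ ℤ.^ k) / 1
  θL-suc k = trans (ℚ.*-comm (ι (suc k)) (L (suc k))) (/-*-cancel (-1ℤ ℤ.^ k) (suc k))

-- The differential equation (1 + t) f′ = x f with f(0) = 1, written on coefficients; its solution
-- is (1 + t)^x.
record IsBinomial (x : ℚ) (p : ℕ → ℚ) : Set where
  field
    initial : p 0 ≡ 1ℚ
    step    : ∀ n → ι (suc n) * p (suc n) ≡ (x - ι n) * p n

open IsBinomial

binomial-unique : ∀ {x p q} → IsBinomial x p → IsBinomial x q → p ≗ q
binomial-unique P Q zero    = trans (initial P) (sym (initial Q))
binomial-unique {x} {p} {q} P Q (suc n) = ι-cancel n (begin-equality
  ι (suc n) * p (suc n)  ≡⟨ step P n ⟩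
  (x - ι n) * p n        ≡⟨ cong ((x - ι n) *_) (binomial-unique P Q n) ⟩
  (x - ι n) * q n        ≡⟨ step Q n ⟨
  ι (suc n) * q (suc n)  ∎)

-- For the exponents 0 and 1 the binomial series is 1 and 1 + t. These are the exponents met at the
-- end points of the integral.
binomial-0 : IsBinomial 0ℚ δ
binomial-0 = record { initial = refl ; step = go }
  where
  go : ∀ n → ι (suc n) * δ (suc n) ≡ (0ℚ - ι n) * δ n
  go zero    = refl
  go (suc n) = trans (ℚ.*-zeroʳ (ι (suc (suc n)))) (sym (ℚ.*-zeroʳ (0ℚ - ι (suc n))))

binomial-1 : IsBinomial 1ℚ (λ n → δ n + var n)
binomial-1 = record { initial = refl ; step = go }
  where
  go : ∀ n → ι (suc n) * (δ (suc n) + var (suc n)) ≡ (1ℚ - ι n) * (δ n + var n)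
  go zero          = refl
  go (suc zero)    = refl
  go (suc (suc n)) = trans (ℚ.*-zeroʳ (ι (suc (suc (suc n))))) (sym (ℚ.*-zeroʳ (1ℚ - ι (suc (suc n)))))

-- L ⋆ p satisfies the x-derivative of the recurrence defining p: both express that
-- log(1 + t) (1 + t)^x is the x-derivative of (1 + t)^x.
L⋆binomial-step : ∀ {x p} → IsBinomial x p → ∀ n →
  ι (suc n) * (L ⋆ p) (suc n) ≡ p n + (x - ι n) * (L ⋆ p) n
L⋆binomial-step {x} {p} P n = begin-equality
  ι (suc n) * (L ⋆ p) (suc n)
    ≡⟨ ⋆-leibniz L p (suc n) ⟩
  (θ L ⋆ p) (suc n) + (L ⋆ θ p) (suc n)
    ≡⟨ cong₂ _+_ θL⋆p L⋆θp ⟩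
  A′ + (x * c + - 1ℚ * B)
    -- Adding and subtracting `A` makes both sums recognisable: `A′ + A` is (1 + t) times the
    -- derivative of log(1 + t), convolved with `p`, and `A + B` is `θ (L ⋆ p) n` by the Leibniz
    -- rule.
    ≡⟨ lem A′ (x * c) A B ⟩
  (A′ + A) + (x * c - (A + B))
    ≡⟨ cong₂ (λ u v → u + (x * c - v)) A′+A (sym (⋆-leibniz L p n)) ⟩
  p n + (x * c - ι n * c)
    ≡⟨ lem′ (p n) x (ι n) c ⟩
  p n + (x - ι n) * c ∎
  where
  A = (θ L ⋆ p) n
  A′ = ((θ L ∘ suc) ⋆ p) n
  B = (L ⋆ θ p) n
  c = (L ⋆ p) n

  A′+A : A′ + A ≡ p n
  A′+A = begin-equality
    A′ + A                                     ≡⟨ ⋆-+ˡ (θ L ∘ suc) (θ L) p n ⟨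
    ((λ i → θ L (suc i) + θ L i) ⋆ p) n        ≡⟨ ⋆-cong {g = p} θL-rec (λ _ → refl) n ⟩
    (δ ⋆ p) n                                  ≡⟨ δ⋆ p n ⟩
    p n                                        ∎

  θL⋆p : (θ L ⋆ p) (suc n) ≡ A′
  θL⋆p = trans (cong (_+ A′) (ℚ.*-zeroˡ (p (suc n)))) (ℚ.+-identityˡ A′)

  expand : ∀ x k q → (x - k) * q ≡ x * q + - 1ℚ * (k * q)
  expand = solve-∀ ring

  drop-last : ∀ y l z → y + l * (0ℚ * z) ≡ y
  drop-last = solve-∀ ring

  L⋆θp : (L ⋆ θ p) (suc n) ≡ x * c + - 1ℚ * B
  L⋆θp = begin-equality
    (L ⋆ θ p) (suc n)
      ≡⟨ ⋆-snoc L (θ p) n ⟩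
    (L ⋆ (θ p ∘ suc)) n + L (suc n) * (0ℚ * p 0)
      ≡⟨ drop-last ((L ⋆ (θ p ∘ suc)) n) (L (suc n)) (p 0) ⟩
    (L ⋆ (θ p ∘ suc)) n
      ≡⟨ ⋆-cong {L} (λ _ → refl) (λ k → trans (step P k) (expand x (ι k) (p k))) n ⟩
    (L ⋆ (λ k → x * p k + - 1ℚ * θ p k)) n
      ≡⟨ ⋆-+ʳ L (λ k → x * p k) (λ k → - 1ℚ * θ p k) n ⟩
    (L ⋆ (λ k → x * p k)) n + (L ⋆ (λ k → - 1ℚ * θ p k)) n
      ≡⟨ cong₂ _+_ (⋆-*ʳ x L p n) (⋆-*ʳ (- 1ℚ) L (θ p) n) ⟩
    x * c + - 1ℚ * B ∎

  lem : ∀ a′ y a b → a′ + (y + - 1ℚ * b) ≡ (a′ + a) + (y - (a + b))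
  lem = solve-∀ ring
  lem′ : ∀ q x k c → q + (x * c - k * c) ≡ q + (x - k) * c
  lem′ = solve-∀ ring

-- binomₚ n is the polynomial binom(α + β t, n).
module _ (α β : ℚ) where

  linearFactor : ℕ → Poly
  linearFactor n = (α - ι n) ∷ β ∷ []

  binomₚ : ℕ → Poly
  binomₚ zero    = const 1ℚ
  binomₚ (suc n) = scale (reciprocal n) (mul (linearFactor n) (binomₚ n))

  ι*reciprocal* : ∀ n z → ι (suc n) * (reciprocal n * z) ≡ z
  ι*reciprocal* n z = begin-equality
    ι (suc n) * (reciprocal n * z)  ≡⟨ lem (ι (suc n)) (reciprocal n) z ⟩
    reciprocal n * ι (suc n) * z    ≡⟨ cong (_* z) (/-*-cancel (+ 1) (suc n)) ⟩
    1ℚ * z                          ≡⟨ ℚ.*-identityˡ z ⟩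
    z                               ∎
    where
    lem : ∀ a b z → a * (b * z) ≡ b * a * z
    lem = solve-∀ ring

  ⟦linearFactor⟧ : ∀ n t → ⟦ linearFactor n ⟧ t ≡ (α + t * β) - ι n
  ⟦linearFactor⟧ n t = lem α β (ι n) t
    where
    lem : ∀ a b k t → (a - k) + t * (b + t * 0ℚ) ≡ (a + t * b) - k
    lem = solve-∀ ring

  binomₚ-isBinomial : ∀ t → IsBinomial (α + t * β) (λ n → ⟦ binomₚ n ⟧ t)
  binomₚ-isBinomial t = record
    { initial = trans (cong (_+_ 1ℚ) (ℚ.*-zeroʳ t)) (ℚ.+-identityʳ 1ℚ)
    ; step    = λ n → begin-equality
        ι (suc n) * ⟦ binomₚ (suc n) ⟧ t
          ≡⟨ cong (ι (suc n) *_) (⟦scale⟧ (reciprocal n) (mul (linearFactor n) (binomₚ n)) t) ⟩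
        ι (suc n) * (reciprocal n * ⟦ mul (linearFactor n) (binomₚ n) ⟧ t)
          ≡⟨ ι*reciprocal* n (⟦ mul (linearFactor n) (binomₚ n) ⟧ t) ⟩
        ⟦ mul (linearFactor n) (binomₚ n) ⟧ t
          ≡⟨ ⟦mul⟧ (linearFactor n) (binomₚ n) t ⟩
        ⟦ linearFactor n ⟧ t * ⟦ binomₚ n ⟧ t
          ≡⟨ cong (_* ⟦ binomₚ n ⟧ t) (⟦linearFactor⟧ n t) ⟩
        ((α + t * β) - ι n) * ⟦ binomₚ n ⟧ t ∎
    }

  -- The t-derivative of the recurrence for binom(α + β t, n), brought to the shape of
  -- `L⋆binomial-step`.
  ⟦deriv-binomₚ⟧-step : ∀ t n →
    ι (suc n) * ⟦ deriv (binomₚ (suc n)) ⟧ t ≡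
    β * ⟦ binomₚ n ⟧ t + ((α + t * β) - ι n) * ⟦ deriv (binomₚ n) ⟧ t
  ⟦deriv-binomₚ⟧-step t n = begin-equality
    ι (suc n) * ⟦ deriv (scale (reciprocal n) q) ⟧ t
      ≡⟨ cong (λ r → ι (suc n) * ⟦ r ⟧ t) (deriv-scale (reciprocal n) q) ⟩
    ι (suc n) * ⟦ scale (reciprocal n) (deriv q) ⟧ t
      ≡⟨ cong (ι (suc n) *_) (⟦scale⟧ (reciprocal n) (deriv q) t) ⟩
    ι (suc n) * (reciprocal n * ⟦ deriv q ⟧ t)
      ≡⟨ ι*reciprocal* n (⟦ deriv q ⟧ t) ⟩
    ⟦ deriv q ⟧ t
      ≡⟨ ⟦deriv-mul⟧ (linearFactor n) (binomₚ n) t ⟩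
    (1ℚ * β + t * 0ℚ) * ⟦ binomₚ n ⟧ t + ⟦ linearFactor n ⟧ t * ⟦ deriv (binomₚ n) ⟧ t
      ≡⟨ cong₂ (λ u v → u * ⟦ binomₚ n ⟧ t + v * ⟦ deriv (binomₚ n) ⟧ t) (lem β t) (⟦linearFactor⟧ n t) ⟩
    β * ⟦ binomₚ n ⟧ t + ((α + t * β) - ι n) * ⟦ deriv (binomₚ n) ⟧ t ∎
    where
    q = mul (linearFactor n) (binomₚ n)
    lem : ∀ b t → 1ℚ * b + t * 0ℚ ≡ b
    lem = solve-∀ ring

  -- The coefficient form of d/dt (1+y)^(α+βt) = β log(1+y) (1+y)^(α+βt): both sides start at 0 and
  -- obey the same recurrence.
  ⟦deriv-binomₚ⟧ : ∀ t n → ⟦ deriv (binomₚ n) ⟧ t ≡ β * (L ⋆ λ k → ⟦ binomₚ k ⟧ t) n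
  ⟦deriv-binomₚ⟧ t zero    = sym (lem β (⟦ binomₚ 0 ⟧ t))
    where
    lem : ∀ b z → b * (0ℚ * z + 0ℚ) ≡ 0ℚ
    lem = solve-∀ ring
  ⟦deriv-binomₚ⟧ t (suc n) = ι-cancel n (begin-equality
    ι (suc n) * ⟦ deriv (binomₚ (suc n)) ⟧ t
      ≡⟨ ⟦deriv-binomₚ⟧-step t n ⟩
    β * p n + (x - ι n) * ⟦ deriv (binomₚ n) ⟧ t
      ≡⟨ cong (λ d → β * p n + (x - ι n) * d) (⟦deriv-binomₚ⟧ t n) ⟩
    β * p n + (x - ι n) * (β * (L ⋆ p) n)
      ≡⟨ lem β (p n) (x - ι n) ((L ⋆ p) n) ⟩
    β * (p n + (x - ι n) * (L ⋆ p) n)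
      ≡⟨ cong (β *_) (L⋆binomial-step (binomₚ-isBinomial t) n) ⟨
    β * (ι (suc n) * (L ⋆ p) (suc n))
      ≡⟨ lem′ β (ι (suc n)) ((L ⋆ p) (suc n)) ⟩
    ι (suc n) * (β * (L ⋆ p) (suc n)) ∎)
    where
    x = α + t * β
    p : ℕ → ℚ
    p k = ⟦ binomₚ k ⟧ t
    lem : ∀ b q y c → b * q + y * (b * c) ≡ b * (q + y * c)
    lem = solve-∀ ring
    lem′ : ∀ b k c → b * (k * c) ≡ k * (b * c)
    lem′ = solve-∀ ring

  -- The functional is left open because the rule is used under evaluation, under further
  -- derivatives and under integrals against a fixed polynomial.
  linear-deriv-binomₚ : ∀ {φ} → Linear φ → ∀ n → φ (deriv (binomₚ n)) ≡ β * (L ⋆ (φ ∘ binomₚ)) n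
  linear-deriv-binomₚ {φ} lin n = begin-equality
    φ (deriv (binomₚ n))
      ≡⟨ linear-ext lin (deriv (binomₚ n)) (scale β ((L ⋆ₚ binomₚ) n)) (λ t → begin-equality
           ⟦ deriv (binomₚ n) ⟧ t                ≡⟨ ⟦deriv-binomₚ⟧ t n ⟩
           β * (L ⋆ λ k → ⟦ binomₚ k ⟧ t) n      ≡⟨ cong (β *_) (linear-⋆ₚ (⟦⟧-linear t) L binomₚ n) ⟨
           β * ⟦ (L ⋆ₚ binomₚ) n ⟧ t             ≡⟨ ⟦scale⟧ β ((L ⋆ₚ binomₚ) n) t ⟨
           ⟦ scale β ((L ⋆ₚ binomₚ) n) ⟧ t       ∎) ⟩
    φ (scale β ((L ⋆ₚ binomₚ) n))
      ≡⟨ scale-homo lin β ((L ⋆ₚ binomₚ) n) ⟩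
    β * φ ((L ⋆ₚ binomₚ) n)
      ≡⟨ cong (β *_) (linear-⋆ₚ lin L binomₚ n) ⟩
    β * (L ⋆ (φ ∘ binomₚ)) n ∎

-- Factorials and the values of `binom`

∏-snoc : ∀ (g : ℕ → ℚ) n → ∏ {suc n} (g ∘ toℕ) ≡ ∏ {n} (g ∘ toℕ) * g n
∏-snoc g zero    = ℚ.*-comm (g 0) 1ℚ
∏-snoc g (suc n) = trans
  (cong (g 0 *_) (∏-snoc (g ∘ suc) n))
  (sym (ℚ.*-assoc (g 0) (∏ {n} (g ∘ suc ∘ toℕ)) (g (suc n))))

ι-! : ∀ n → ι (suc n !) ≡ ι (suc n) * ι (n !)
ι-! n = trans (cong (_/ 1) (ℤ.pos-* (suc n) (n !))) (/1-homo-* (+ suc n) (+ (n !)))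

1/! : ℕ → ℚ
1/! n = (+ 1 / (n !)) {{n !≢0}}

1/!-step : ∀ n → ι (suc n) * 1/! (suc n) ≡ 1/! n
1/!-step n = begin-equality
  ι (suc n) * r′                    ≡⟨ ℚ.*-identityʳ (ι (suc n) * r′) ⟨
  (ι (suc n) * r′) * 1ℚ             ≡⟨ cong ((ι (suc n) * r′) *_) (/-*-cancel (+ 1) (n !) {{n !≢0}}) ⟨
  (ι (suc n) * r′) * (r * ι (n !))  ≡⟨ lem (ι (suc n)) r′ r (ι (n !)) ⟩
  r * (r′ * (ι (suc n) * ι (n !)))  ≡⟨ cong (λ k → r * (r′ * k)) (ι-! n) ⟨
  r * (r′ * ι (suc n !))            ≡⟨ cong (r *_) (/-*-cancel (+ 1) (suc n !) {{suc n !≢0}}) ⟩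
  r * 1ℚ                            ≡⟨ ℚ.*-identityʳ r ⟩
  r                                 ∎
  where
  r  = 1/! n
  r′ = 1/! (suc n)
  lem : ∀ k r′ r f → (k * r′) * (r * f) ≡ r * (r′ * (k * f))
  lem = solve-∀ ring

binom-isBinomial : ∀ t → IsBinomial t (binom t)
binom-isBinomial t = record { initial = refl ; step = go }
  where
  factor : ℕ → ℚ
  factor i = t - ι i
  lem : ∀ k P f r → k * ((P * f) * r) ≡ f * (P * (k * r))
  lem = solve-∀ ring
  go : ∀ n → ι (suc n) * binom t (suc n) ≡ (t - ι n) * binom t n
  go n = begin-equality
    ι (suc n) * (∏ {suc n} (factor ∘ toℕ) * 1/! (suc n))
      ≡⟨ cong (λ P → ι (suc n) * (P * 1/! (suc n))) (∏-snoc factor n) ⟩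
    ι (suc n) * ((∏ {n} (factor ∘ toℕ) * factor n) * 1/! (suc n))
      ≡⟨ lem (ι (suc n)) (∏ {n} (factor ∘ toℕ)) (factor n) (1/! (suc n)) ⟩
    factor n * (∏ {n} (factor ∘ toℕ) * (ι (suc n) * 1/! (suc n)))
      ≡⟨ cong (λ r → factor n * (∏ {n} (factor ∘ toℕ) * r)) (1/!-step n) ⟩
    factor n * (∏ {n} (factor ∘ toℕ) * 1/! n) ∎

-- B m = binom(t, m) and, below, A n = binom(1 - t, n).
B : ℕ → Poly
B = binomₚ 0ℚ 1ℚ

⟦B⟧ : ∀ n t → ⟦ B n ⟧ t ≡ binom t n
⟦B⟧ n t = binomial-unique
  (subst (λ x → IsBinomial x (λ n → ⟦ B n ⟧ t)) (lem t) (binomₚ-isBinomial 0ℚ 1ℚ t))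
  (binom-isBinomial t) n
  where
  lem : ∀ t → 0ℚ + t * 1ℚ ≡ t
  lem = solve-∀ ring

-- Stirling polynomials as derivatives

module Px  = Polynomials ℤ.+-*-rawRing
module Pxy = Polynomials ℤ[x]
open RawSemiringDefinitions (RawRing.rawSemiring ℤ[x][y]) using () renaming (product to ∏ₓᵧ)

eval-add : ∀ p q s → eval (Px.add p q) s ≡ eval p s + eval q s
eval-add []      q       s = sym (ℚ.+-identityˡ (eval q s))
eval-add (a ∷ p) []      s = sym (ℚ.+-identityʳ (eval (a ∷ p) s))
eval-add (a ∷ p) (b ∷ q) s = trans
  (cong₂ (λ c v → c + s * v) (/1-homo-+ a b) (eval-add p q s))
  (lem (a / 1) (b / 1) s (eval p s) (eval q s))
  where
  lem : ∀ a b t x y → a + b + t * (x + y) ≡ (a + t * x) + (b + t * y)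
  lem = solve-∀ ring

eval-scale : ∀ c p s → eval (map (c ℤ.*_) p) s ≡ c / 1 * eval p s
eval-scale c []      s = sym (ℚ.*-zeroʳ (c / 1))
eval-scale c (a ∷ p) s = trans
  (cong₂ (λ x v → x + s * v) (/1-homo-* c a) (eval-scale c p s))
  (lem (c / 1) (a / 1) s (eval p s))
  where
  lem : ∀ c a t x → c * a + t * (c * x) ≡ c * (a + t * x)
  lem = solve-∀ ring

eval-mul : ∀ p q s → eval (Px.mul p q) s ≡ eval p s * eval q s
eval-mul []      q s = sym (ℚ.*-zeroˡ (eval q s))
eval-mul (a ∷ p) q s = begin-equality
  eval (Px.add (map (a ℤ.*_) q) (+ 0 ∷ Px.mul p q)) s
    ≡⟨ eval-add (map (a ℤ.*_) q) (+ 0 ∷ Px.mul p q) s ⟩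
  eval (map (a ℤ.*_) q) s + (0ℚ + s * eval (Px.mul p q) s)
    ≡⟨ cong₂ (λ u v → u + (0ℚ + s * v)) (eval-scale a q s) (eval-mul p q s) ⟩
  a / 1 * eval q s + (0ℚ + s * (eval p s * eval q s))
    ≡⟨ lem (a / 1) s (eval p s) (eval q s) ⟩
  (a / 1 + s * eval p s) * eval q s ∎
  where
  lem : ∀ a t x y → a * y + (0ℚ + t * (x * y)) ≡ (a + t * x) * y
  lem = solve-∀ ring

coeffAt : ℚ → Pxy.Poly → ℕ → ℚ
coeffAt s P k = eval (Pxy.coeff P k) s

coeffAt-add : ∀ s P Q k → coeffAt s (Pxy.add P Q) k ≡ coeffAt s P k + coeffAt s Q k
coeffAt-add s []      Q       k       = sym (ℚ.+-identityˡ (coeffAt s Q k))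
coeffAt-add s (p ∷ P) []      k       = sym (ℚ.+-identityʳ (coeffAt s (p ∷ P) k))
coeffAt-add s (p ∷ P) (q ∷ Q) zero    = eval-add p q s
coeffAt-add s (p ∷ P) (q ∷ Q) (suc k) = coeffAt-add s P Q k

coeffAt-scale : ∀ s a P k → coeffAt s (map (Px.mul a) P) k ≡ eval a s * coeffAt s P k
coeffAt-scale s a []      k       = sym (ℚ.*-zeroʳ (eval a s))
coeffAt-scale s a (p ∷ P) zero    = eval-mul a p s
coeffAt-scale s a (p ∷ P) (suc k) = coeffAt-scale s a P k

coeffAt-0 : ∀ s k → coeffAt s ([] ∷ []) k ≡ 0ℚ
coeffAt-0 s zero    = refl
coeffAt-0 s (suc k) = refl

x+y+ : ℕ → Pxy.Poly
x+y+ c = Pxy.add (Pxy.add (Pxy.const Px.indeterminate) Pxy.indeterminate) (Pxy.const (Px.const (+ c)))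

-- `x+y+ c` computes to the list with entries c + x and 1, so multiplying by it gives (c + x) P plus
-- a shifted copy of P. The `[] ∷ []` left over from unfolding `mul` evaluates to 0.
coeffAt-x+y+-zero : ∀ s c P → coeffAt s (Pxy.mul (x+y+ c) P) 0 ≡ (s + ι c) * coeffAt s P 0
coeffAt-x+y+-zero s c P = begin-equality
  coeffAt s (Pxy.mul (x+y+ c) P) 0
    ≡⟨ coeffAt-add s (map (Px.mul (+ c ∷ + 1 ∷ [])) P) ([] ∷ Pxy.add (map (Px.mul (+ 1 ∷ [])) P) ([] ∷ [])) 0 ⟩
  coeffAt s (map (Px.mul (+ c ∷ + 1 ∷ [])) P) 0 + 0ℚ
    ≡⟨ ℚ.+-identityʳ (coeffAt s (map (Px.mul (+ c ∷ + 1 ∷ [])) P) 0) ⟩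
  coeffAt s (map (Px.mul (+ c ∷ + 1 ∷ [])) P) 0
    ≡⟨ coeffAt-scale s (+ c ∷ + 1 ∷ []) P 0 ⟩
  (ι c + s * (1ℚ + s * 0ℚ)) * coeffAt s P 0
    ≡⟨ lem (ι c) s (coeffAt s P 0) ⟩
  (s + ι c) * coeffAt s P 0 ∎
  where
  lem : ∀ c s e → (c + s * (1ℚ + s * 0ℚ)) * e ≡ (s + c) * e
  lem = solve-∀ ring

coeffAt-x+y+-suc : ∀ s c P k →
  coeffAt s (Pxy.mul (x+y+ c) P) (suc k) ≡ (s + ι c) * coeffAt s P (suc k) + coeffAt s P k
coeffAt-x+y+-suc s c P k = begin-equality
  coeffAt s (Pxy.mul (x+y+ c) P) (suc k)
    ≡⟨ coeffAt-add s (map (Px.mul (+ c ∷ + 1 ∷ [])) P) ([] ∷ Pxy.add (map (Px.mul (+ 1 ∷ [])) P) ([] ∷ [])) (suc k) ⟩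
  coeffAt s (map (Px.mul (+ c ∷ + 1 ∷ [])) P) (suc k) + coeffAt s (Pxy.add (map (Px.mul (+ 1 ∷ [])) P) ([] ∷ [])) k
    ≡⟨ cong₂ _+_ (coeffAt-scale s (+ c ∷ + 1 ∷ []) P (suc k))
         (trans (coeffAt-add s (map (Px.mul (+ 1 ∷ [])) P) ([] ∷ []) k)
           (cong₂ _+_ (coeffAt-scale s (+ 1 ∷ []) P k) (coeffAt-0 s k))) ⟩
  (ι c + s * (1ℚ + s * 0ℚ)) * coeffAt s P (suc k) + ((1ℚ + s * 0ℚ) * coeffAt s P k + 0ℚ)
    ≡⟨ lem (ι c) s (coeffAt s P (suc k)) (coeffAt s P k) ⟩
  (s + ι c) * coeffAt s P (suc k) + coeffAt s P k ∎
  where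
  lem : ∀ c s e f → (c + s * (1ℚ + s * 0ℚ)) * e + ((1ℚ + s * 0ℚ) * f + 0ℚ) ≡ (s + c) * e + f
  lem = solve-∀ ring

-- The polynomial ∏ (t - 1 + c i), obtained from ∏ (x + y + c i) at x + y = t - 1.
-- As x and y enter only through their sum, the coefficient of y^k at x = t - 1 is
-- the k-th derivative divided by k!.
risingₚ : (ℕ → ℕ) → ℕ → Poly
risingₚ c zero    = const 1ℚ
risingₚ c (suc n) = mul ((- 1ℚ + ι (c 0)) ∷ 1ℚ ∷ []) (risingₚ (c ∘ suc) n)

⟦rising-factor⟧ : ∀ c t → ⟦ (- 1ℚ + ι c) ∷ 1ℚ ∷ [] ⟧ t ≡ (t - 1ℚ) + ι c
⟦rising-factor⟧ c t = lem (ι c) t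
  where
  lem : ∀ c t → (- 1ℚ + c) + t * (1ℚ + t * 0ℚ) ≡ (t - 1ℚ) + c
  lem = solve-∀ ring

⟦rising-factor-deriv⟧ : ∀ t → 1ℚ * 1ℚ + t * 0ℚ ≡ 1ℚ
⟦rising-factor-deriv⟧ = solve-∀ ring

-- The product rule is an identity of values and cannot be differentiated by rewriting; `linear-ext`
-- for the functional `dev` does it.
⟦deriv²-mul⟧ : ∀ p q t → ⟦ deriv (deriv (mul p q)) ⟧ t ≡
  ⟦ deriv (deriv p) ⟧ t * ⟦ q ⟧ t + (⟦ deriv p ⟧ t * ⟦ deriv q ⟧ t + ⟦ deriv p ⟧ t * ⟦ deriv q ⟧ t)
    + ⟦ p ⟧ t * ⟦ deriv (deriv q) ⟧ t
⟦deriv²-mul⟧ p q t = begin-equality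
  ⟦ deriv (deriv (mul p q)) ⟧ t
    ≡⟨ linear-ext dev (deriv (mul p q)) (add (mul (deriv p) q) (mul p (deriv q))) (λ u →
         trans (⟦deriv-mul⟧ p q u) (sym (trans (⟦add⟧ (mul (deriv p) q) (mul p (deriv q)) u)
           (cong₂ _+_ (⟦mul⟧ (deriv p) q u) (⟦mul⟧ p (deriv q) u))))) ⟩
  ⟦ deriv (add (mul (deriv p) q) (mul p (deriv q))) ⟧ t
    ≡⟨ add-homo dev (mul (deriv p) q) (mul p (deriv q)) ⟩
  ⟦ deriv (mul (deriv p) q) ⟧ t + ⟦ deriv (mul p (deriv q)) ⟧ t
    ≡⟨ cong₂ _+_ (⟦deriv-mul⟧ (deriv p) q t) (⟦deriv-mul⟧ p (deriv q) t) ⟩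
  (⟦ deriv (deriv p) ⟧ t * ⟦ q ⟧ t + ⟦ deriv p ⟧ t * ⟦ deriv q ⟧ t) +
  (⟦ deriv p ⟧ t * ⟦ deriv q ⟧ t + ⟦ p ⟧ t * ⟦ deriv (deriv q) ⟧ t)
    ≡⟨ lem (⟦ deriv (deriv p) ⟧ t * ⟦ q ⟧ t) (⟦ deriv p ⟧ t * ⟦ deriv q ⟧ t) (⟦ p ⟧ t * ⟦ deriv (deriv q) ⟧ t) ⟩
  ⟦ deriv (deriv p) ⟧ t * ⟦ q ⟧ t + (⟦ deriv p ⟧ t * ⟦ deriv q ⟧ t + ⟦ deriv p ⟧ t * ⟦ deriv q ⟧ t)
    + ⟦ p ⟧ t * ⟦ deriv (deriv q) ⟧ t ∎
  where
  dev = ∘deriv-linear (⟦⟧-linear t)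
  lem : ∀ x y z → (x + y) + (y + z) ≡ x + (y + y) + z
  lem = solve-∀ ring

-- The offsets `c` are arbitrary because each induction step strips the first factor and leaves the
-- offsets `c ∘ suc`.
coeffAt-rising-0 : ∀ c n t → coeffAt (t - 1ℚ) (∏ₓᵧ {n} (x+y+ ∘ c ∘ toℕ)) 0 ≡ ⟦ risingₚ c n ⟧ t
coeffAt-rising-0 c zero t = lem t
  where
  lem : ∀ t → 1ℚ + (t - 1ℚ) * 0ℚ ≡ 1ℚ + t * 0ℚ
  lem = solve-∀ ring
coeffAt-rising-0 c (suc n) t = begin-equality
  coeffAt (t - 1ℚ) (∏ₓᵧ {suc n} (x+y+ ∘ c ∘ toℕ)) 0
    ≡⟨ coeffAt-x+y+-zero (t - 1ℚ) (c 0) (∏ₓᵧ {n} (x+y+ ∘ c ∘ suc ∘ toℕ)) ⟩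
  ((t - 1ℚ) + ι (c 0)) * coeffAt (t - 1ℚ) (∏ₓᵧ {n} (x+y+ ∘ c ∘ suc ∘ toℕ)) 0
    ≡⟨ cong₂ _*_ (sym (⟦rising-factor⟧ (c 0) t)) (coeffAt-rising-0 (c ∘ suc) n t) ⟩
  ⟦ (- 1ℚ + ι (c 0)) ∷ 1ℚ ∷ [] ⟧ t * ⟦ risingₚ (c ∘ suc) n ⟧ t
    ≡⟨ ⟦mul⟧ ((- 1ℚ + ι (c 0)) ∷ 1ℚ ∷ []) (risingₚ (c ∘ suc) n) t ⟨
  ⟦ risingₚ c (suc n) ⟧ t ∎

coeffAt-rising-1 : ∀ c n t → coeffAt (t - 1ℚ) (∏ₓᵧ {n} (x+y+ ∘ c ∘ toℕ)) 1 ≡ ⟦ deriv (risingₚ c n) ⟧ t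
coeffAt-rising-1 c zero    t = refl
coeffAt-rising-1 c (suc n) t = begin-equality
  coeffAt (t - 1ℚ) (∏ₓᵧ {suc n} (x+y+ ∘ c ∘ toℕ)) 1
    ≡⟨ coeffAt-x+y+-suc (t - 1ℚ) (c 0) Π 0 ⟩
  ((t - 1ℚ) + ι (c 0)) * coeffAt (t - 1ℚ) Π 1 + coeffAt (t - 1ℚ) Π 0
    ≡⟨ cong₂ (λ x y → ((t - 1ℚ) + ι (c 0)) * x + y) (coeffAt-rising-1 (c ∘ suc) n t) (coeffAt-rising-0 (c ∘ suc) n t) ⟩
  ((t - 1ℚ) + ι (c 0)) * ⟦ deriv R ⟧ t + ⟦ R ⟧ t
    ≡⟨ lem ((t - 1ℚ) + ι (c 0)) (⟦ deriv R ⟧ t) (⟦ R ⟧ t) ⟩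
  1ℚ * ⟦ R ⟧ t + ((t - 1ℚ) + ι (c 0)) * ⟦ deriv R ⟧ t
    ≡⟨ cong₂ (λ x y → x * ⟦ R ⟧ t + y * ⟦ deriv R ⟧ t) (⟦rising-factor-deriv⟧ t) (⟦rising-factor⟧ (c 0) t) ⟨
  (1ℚ * 1ℚ + t * 0ℚ) * ⟦ R ⟧ t + ⟦ (- 1ℚ + ι (c 0)) ∷ 1ℚ ∷ [] ⟧ t * ⟦ deriv R ⟧ t
    ≡⟨ ⟦deriv-mul⟧ ((- 1ℚ + ι (c 0)) ∷ 1ℚ ∷ []) R t ⟨
  ⟦ deriv (risingₚ c (suc n)) ⟧ t ∎
  where
  Π = ∏ₓᵧ {n} (x+y+ ∘ c ∘ suc ∘ toℕ)
  R = risingₚ (c ∘ suc) n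
  lem : ∀ f d r → f * d + r ≡ 1ℚ * r + f * d
  lem = solve-∀ ring

-- Doubling the coefficient clears the 1/2! of the Taylor coefficient, so that no division enters
-- the induction.
coeffAt-rising-2 : ∀ c n t →
  coeffAt (t - 1ℚ) (∏ₓᵧ {n} (x+y+ ∘ c ∘ toℕ)) 2 + coeffAt (t - 1ℚ) (∏ₓᵧ {n} (x+y+ ∘ c ∘ toℕ)) 2 ≡
  ⟦ deriv (deriv (risingₚ c n)) ⟧ t
coeffAt-rising-2 c zero    t = refl
coeffAt-rising-2 c (suc n) t = begin-equality
  E₂ + E₂
    ≡⟨ cong (λ e → e + e) (coeffAt-x+y+-suc (t - 1ℚ) (c 0) Π 1) ⟩
  (f * e₂ + e₁) + (f * e₂ + e₁)
    -- The inserted `0ℚ` is the second derivative of the linear factor, which gives the line the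
    -- form of the Leibniz rule of order two.
    ≡⟨ lem f e₂ e₁ (⟦ R ⟧ t) ⟩
  0ℚ * ⟦ R ⟧ t + (1ℚ * e₁ + 1ℚ * e₁) + f * (e₂ + e₂)
    ≡⟨ cong₂ (λ x y → 0ℚ * ⟦ R ⟧ t + (1ℚ * x + 1ℚ * x) + f * y)
         (coeffAt-rising-1 (c ∘ suc) n t) (coeffAt-rising-2 (c ∘ suc) n t) ⟩
  0ℚ * ⟦ R ⟧ t + (1ℚ * ⟦ deriv R ⟧ t + 1ℚ * ⟦ deriv R ⟧ t) + f * ⟦ deriv (deriv R) ⟧ t
    ≡⟨ cong₂ (λ x y → 0ℚ * ⟦ R ⟧ t + (x * ⟦ deriv R ⟧ t + x * ⟦ deriv R ⟧ t) + y * ⟦ deriv (deriv R) ⟧ t)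
         (⟦rising-factor-deriv⟧ t) (⟦rising-factor⟧ (c 0) t) ⟨
  0ℚ * ⟦ R ⟧ t + (ℓ′ * ⟦ deriv R ⟧ t + ℓ′ * ⟦ deriv R ⟧ t) + ⟦ ℓ ⟧ t * ⟦ deriv (deriv R) ⟧ t
    ≡⟨ ⟦deriv²-mul⟧ ℓ R t ⟨
  ⟦ deriv (deriv (risingₚ c (suc n))) ⟧ t ∎
  where
  Π = ∏ₓᵧ {n} (x+y+ ∘ c ∘ suc ∘ toℕ)
  R = risingₚ (c ∘ suc) n
  ℓ = (- 1ℚ + ι (c 0)) ∷ 1ℚ ∷ []
  ℓ′ = 1ℚ * 1ℚ + t * 0ℚ
  f = (t - 1ℚ) + ι (c 0)
  E₂ = coeffAt (t - 1ℚ) (∏ₓᵧ {suc n} (x+y+ ∘ c ∘ toℕ)) 2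
  e₂ = coeffAt (t - 1ℚ) Π 2
  e₁ = coeffAt (t - 1ℚ) Π 1
  lem : ∀ f d e r → (f * d + e) + (f * d + e) ≡ 0ℚ * r + (1ℚ * e + 1ℚ * e) + f * (d + d)
  lem = solve-∀ ring

⟦risingₚ⟧ : ∀ c n t → ⟦ risingₚ c n ⟧ t ≡ ∏ {n} (λ i → (t - 1ℚ) + ι (c (toℕ i)))
⟦risingₚ⟧ c zero    t = trans (cong (_+_ 1ℚ) (ℚ.*-zeroʳ t)) (ℚ.+-identityʳ 1ℚ)
⟦risingₚ⟧ c (suc n) t = trans
  (⟦mul⟧ ((- 1ℚ + ι (c 0)) ∷ 1ℚ ∷ []) (risingₚ (c ∘ suc) n) t)
  (cong₂ _*_ (⟦rising-factor⟧ (c 0) t) (⟦risingₚ⟧ (c ∘ suc) n t))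

sign : ℕ → ℚ
sign n = (-1ℤ ℤ.^ n) / 1

sign-suc : ∀ n → sign (suc n) ≡ - 1ℚ * sign n
sign-suc n = /1-homo-* -1ℤ (-1ℤ ℤ.^ n)

sign² : ∀ n → sign n * sign n ≡ 1ℚ
sign² zero    = refl
sign² (suc n) = trans
  (cong (λ s → s * s) (sign-suc n))
  (trans (lem (sign n)) (sign² n))
  where
  lem : ∀ s → (- 1ℚ * s) * (- 1ℚ * s) ≡ s * s
  lem = solve-∀ ring

A : ℕ → Poly
A = binomₚ 1ℚ (- 1ℚ)

signed! : ℕ → ℚ
signed! n = sign n * ι (n !)

-- Each factor t - 1 + i is minus the factor (1 - t) - i of n! binom(1 - t, n); the n signs make up
-- `sign n`.
⟦risingₚ⟧-A : ∀ n t → ⟦ risingₚ (λ i → i) n ⟧ t ≡ signed! n * ⟦ A n ⟧ t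
⟦risingₚ⟧-A n t = trans (⟦risingₚ⟧ (λ i → i) n t) (go n)
  where
  factor : ℕ → ℚ
  factor i = (t - 1ℚ) + ι i
  isBin = binomₚ-isBinomial 1ℚ (- 1ℚ) t
  lem : ∀ s f a t k → (s * f * a) * ((t - 1ℚ) + k) ≡ (- 1ℚ * s) * f * (((1ℚ + t * - 1ℚ) - k) * a)
  lem = solve-∀ ring
  lem′ : ∀ s f k a → s * f * (k * a) ≡ s * (k * f) * a
  lem′ = solve-∀ ring
  go : ∀ n → ∏ {n} (factor ∘ toℕ) ≡ signed! n * ⟦ A n ⟧ t
  go zero    = sym (trans (ℚ.*-identityˡ (⟦ A 0 ⟧ t)) (initial isBin))
  go (suc n) = begin-equality
    ∏ {suc n} (factor ∘ toℕ)
      ≡⟨ ∏-snoc factor n ⟩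
    ∏ {n} (factor ∘ toℕ) * factor n
      ≡⟨ cong (_* factor n) (go n) ⟩
    (sign n * ι (n !) * ⟦ A n ⟧ t) * factor n
      ≡⟨ lem (sign n) (ι (n !)) (⟦ A n ⟧ t) t (ι n) ⟩
    (- 1ℚ * sign n) * ι (n !) * (((1ℚ + t * - 1ℚ) - ι n) * ⟦ A n ⟧ t)
      ≡⟨ cong₂ (λ s y → s * ι (n !) * y) (sign-suc n) (step isBin n) ⟨
    sign (suc n) * ι (n !) * (ι (suc n) * ⟦ A (suc n) ⟧ t)
      ≡⟨ lem′ (sign (suc n)) (ι (n !)) (ι (suc n)) (⟦ A (suc n) ⟧ t) ⟩
    sign (suc n) * (ι (suc n) * ι (n !)) * ⟦ A (suc n) ⟧ t
      ≡⟨ cong (λ f → sign (suc n) * f * ⟦ A (suc n) ⟧ t) (ι-! n) ⟨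
    signed! (suc n) * ⟦ A (suc n) ⟧ t ∎

A″ : ℕ → Poly
A″ n = deriv (deriv (A n))

eval-stirling : ∀ n t → eval (stirling n 2) (t - 1ℚ) ≡ ½ * signed! n * ⟦ A″ n ⟧ t
eval-stirling n t = begin-equality
  e                                 ≡⟨ ℚ.*-identityˡ e ⟨
  1ℚ * e                            ≡⟨ ℚ.*-distribʳ-+ e ½ ½ ⟩
  ½ * e + ½ * e                     ≡⟨ ℚ.*-distribˡ-+ ½ e e ⟨
  ½ * (e + e)                       ≡⟨ cong (½ *_) (coeffAt-rising-2 (λ i → i) n t) ⟩
  ½ * ⟦ deriv (deriv (risingₚ (λ i → i) n)) ⟧ t
    ≡⟨ cong (½ *_) (linear-ext dev² (risingₚ (λ i → i) n) (scale (signed! n) (A n))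
         (λ u → trans (⟦risingₚ⟧-A n u) (sym (⟦scale⟧ (signed! n) (A n) u)))) ⟩
  ½ * ⟦ deriv (deriv (scale (signed! n) (A n))) ⟧ t
    ≡⟨ cong (½ *_) (scale-homo dev² (signed! n) (A n)) ⟩
  ½ * (signed! n * ⟦ A″ n ⟧ t)      ≡⟨ ℚ.*-assoc ½ (signed! n) (⟦ A″ n ⟧ t) ⟨
  ½ * signed! n * ⟦ A″ n ⟧ t        ∎
  where
  e = eval (stirling n 2) (t - 1ℚ)
  dev² = ∘deriv-linear (∘deriv-linear (⟦⟧-linear t))

-- Integration of polynomials

0≤- : ∀ {x y} → x ℚ.≤ y → 0ℚ ℚ.≤ y - x
0≤- {x} {y} x≤y = ℚ.≤-trans (ℚ.≤-reflexive (sym (ℚ.+-inverseʳ x))) (ℚ.+-monoˡ-≤ (- x) x≤y)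

0≤* : ∀ {x y} → 0ℚ ℚ.≤ x → 0ℚ ℚ.≤ y → 0ℚ ℚ.≤ x * y
0≤* {x} {y} 0≤x 0≤y = ℚ.≤-trans (ℚ.≤-reflexive (sym (ℚ.*-zeroʳ x))) (*-monoˡ 0≤x 0≤y)

∣∣-triangle : ∀ {x y B C} → ∣ x ∣ ℚ.≤ B → ∣ y ∣ ℚ.≤ C → ∣ x + y ∣ ℚ.≤ B + C
∣∣-triangle {x} {y} x≤B y≤C = ℚ.≤-trans (ℚ.∣p+q∣≤∣p∣+∣q∣ x y) (ℚ.+-mono-≤ x≤B y≤C)

∣*∣-nonNeg : ∀ {x} y → 0ℚ ℚ.≤ x → ∣ x * y ∣ ≡ x * ∣ y ∣
∣*∣-nonNeg {x} y 0≤x = trans (ℚ.∣p*q∣≡∣p∣*∣q∣ x y) (cong (_* ∣ y ∣) (ℚ.0≤p⇒∣p∣≡p 0≤x))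

lipschitz : ∀ p → ∃ λ K → 0ℚ ℚ.≤ K × (∀ {u v} → 0ℚ ℚ.≤ u → u ℚ.≤ v → v ℚ.≤ 1ℚ →
  ∣ ⟦ p ⟧ v - ⟦ p ⟧ u ∣ ℚ.≤ K * (v - u))
lipschitz []      = 0ℚ , ℚ.≤-refl , λ {u} {v} _ _ _ → ℚ.≤-reflexive (sym (ℚ.*-zeroˡ (v - u)))
lipschitz (a ∷ p) with K , 0≤K , p-lip ← lipschitz p | M , 0≤M , p≤M ← bounded p =
  K + M , 0≤+ 0≤K 0≤M , λ {u} {v} 0≤u u≤v v≤1 → begin
    ∣ (a + v * ⟦ p ⟧ v) - (a + u * ⟦ p ⟧ u) ∣
      ≡⟨ cong ∣_∣ (split a u v (⟦ p ⟧ u) (⟦ p ⟧ v)) ⟩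
    ∣ u * (⟦ p ⟧ v - ⟦ p ⟧ u) + (v - u) * ⟦ p ⟧ v ∣
      ≤⟨ ∣∣-triangle
           (ℚ.≤-trans (∣t*x∣≤∣x∣ (⟦ p ⟧ v - ⟦ p ⟧ u) 0≤u (ℚ.≤-trans u≤v v≤1)) (p-lip 0≤u u≤v v≤1))
           (ℚ.≤-trans (ℚ.≤-reflexive (∣*∣-nonNeg (⟦ p ⟧ v) (0≤- u≤v)))
             (*-monoˡ (0≤- u≤v) (p≤M (ℚ.≤-trans 0≤u u≤v) v≤1))) ⟩
    K * (v - u) + (v - u) * M
      ≡⟨ collect K M (v - u) ⟩
    (K + M) * (v - u) ∎
  where
  split : ∀ a u v x y → (a + v * y) - (a + u * x) ≡ u * (y - x) + (v - u) * y
  split = solve-∀ ring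
  collect : ∀ K M h → K * h + h * M ≡ (K + M) * h
  collect = solve-∀ ring

-- The slope is taken at an arbitrary tag between the end points, and the error is still quadratic.
-- For k + t p(t) it equals s times the error for p plus two products, each of a length at most c -
-- a and a Lipschitz difference of p; these account for `K + K`.
taylor : ∀ p → ∃ λ M → 0ℚ ℚ.≤ M × (∀ {a s c} → 0ℚ ℚ.≤ a → a ℚ.≤ s → s ℚ.≤ c → c ℚ.≤ 1ℚ →
  ∣ (⟦ p ⟧ c - ⟦ p ⟧ a) - ⟦ deriv p ⟧ s * (c - a) ∣ ℚ.≤ M * ((c - a) * (c - a)))
taylor []      = 0ℚ , ℚ.≤-refl , λ {a} {s} {c} _ _ _ _ → ℚ.≤-reflexive
  (trans (cong (λ x → ∣ 0ℚ - x ∣) (ℚ.*-zeroˡ (c - a))) (sym (ℚ.*-zeroˡ ((c - a) * (c - a)))))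
taylor (k ∷ p) with M , 0≤M , p-taylor ← taylor p | K , 0≤K , p-lip ← lipschitz p =
  M + (K + K) , 0≤+ 0≤M (0≤+ 0≤K 0≤K) , λ {a} {s} {c} 0≤a a≤s s≤c c≤1 →
  let h = c - a
      0≤s = ℚ.≤-trans 0≤a a≤s
      s≤1 = ℚ.≤-trans s≤c c≤1
      remainder = (⟦ p ⟧ c - ⟦ p ⟧ a) - ⟦ deriv p ⟧ s * h
      s-a≤h = ℚ.+-monoˡ-≤ (- a) s≤c
      c-s≤h = ℚ.+-monoʳ-≤ c (ℚ.neg-antimono-≤ a≤s)
  in begin
    ∣ ((k + c * ⟦ p ⟧ c) - (k + a * ⟦ p ⟧ a)) - ⟦ deriv (k ∷ p) ⟧ s * h ∣
      ≡⟨ cong (λ d → ∣ ((k + c * ⟦ p ⟧ c) - (k + a * ⟦ p ⟧ a)) - d * h ∣) (⟦deriv-∷⟧ k p s) ⟩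
    ∣ ((k + c * ⟦ p ⟧ c) - (k + a * ⟦ p ⟧ a)) - (⟦ p ⟧ s + s * ⟦ deriv p ⟧ s) * h ∣
      ≡⟨ cong ∣_∣ (split k a s c (⟦ p ⟧ a) (⟦ p ⟧ s) (⟦ p ⟧ c) (⟦ deriv p ⟧ s)) ⟩
    ∣ s * remainder + ((c - s) * (⟦ p ⟧ c - ⟦ p ⟧ s) + - ((s - a) * (⟦ p ⟧ s - ⟦ p ⟧ a))) ∣
      ≤⟨ ∣∣-triangle
           (ℚ.≤-trans (∣t*x∣≤∣x∣ remainder 0≤s s≤1) (p-taylor 0≤a a≤s s≤c c≤1))
           (∣∣-triangle
             (product-bound (0≤- s≤c) c-s≤h 0≤K (p-lip 0≤s s≤c c≤1))
             (ℚ.≤-trans (ℚ.≤-reflexive (ℚ.∣-p∣≡∣p∣ ((s - a) * (⟦ p ⟧ s - ⟦ p ⟧ a))))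
               (product-bound (0≤- a≤s) s-a≤h 0≤K (p-lip 0≤a a≤s s≤1)))) ⟩
    M * (h * h) + (K * (h * h) + K * (h * h))
      ≡⟨ collect M K (h * h) ⟩
    (M + (K + K)) * (h * h) ∎
  where
  split : ∀ k a s c pa ps pc d →
    ((k + c * pc) - (k + a * pa)) - (ps + s * d) * (c - a) ≡
    s * ((pc - pa) - d * (c - a)) + ((c - s) * (pc - ps) + - ((s - a) * (ps - pa)))
  split = solve-∀ ring
  collect : ∀ M K q → M * q + (K * q + K * q) ≡ (M + (K + K)) * q
  collect = solve-∀ ring
  product-bound : ∀ {x y h K} → 0ℚ ℚ.≤ x → x ℚ.≤ h → 0ℚ ℚ.≤ K → ∣ y ∣ ℚ.≤ K * x →
    ∣ x * y ∣ ℚ.≤ K * (h * h)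
  product-bound {x} {y} {h} {K} 0≤x x≤h 0≤K ∣y∣≤Kx = begin
    ∣ x * y ∣    ≡⟨ ∣*∣-nonNeg y 0≤x ⟩
    x * ∣ y ∣    ≤⟨ *-monoˡ 0≤x ∣y∣≤Kx ⟩
    x * (K * x)  ≤⟨ *-monoʳ (0≤* 0≤K 0≤x) x≤h ⟩
    h * (K * x)  ≤⟨ *-monoˡ (ℚ.≤-trans 0≤x x≤h) (*-monoˡ 0≤K x≤h) ⟩
    h * (K * h)  ≡⟨ lem h K ⟩
    K * (h * h)  ∎
    where
    lem : ∀ h K → h * (K * h) ≡ K * (h * h)
    lem = solve-∀ ring

partition-≤ : ∀ {a b} → TaggedPartition a b → a ℚ.≤ b
partition-≤ end                    = ℚ.≤-refl
partition-≤ (cell tag c a≤s s≤c P) = ℚ.≤-trans (ℚ.≤-trans a≤s s≤c) (partition-≤ P)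

-- A cell of length h < η has error at most M h² ≤ M η h, and the lengths add up to b - a. `M`
-- precedes `η`, so the mesh can later be chosen in terms of `M`; the end points vary because the
-- induction removes the first cell.
riemannSum-deriv : ∀ F → ∃ λ M → 0ℚ ℚ.≤ M × (∀ η {a b} (P : TaggedPartition a b) →
  0ℚ ℚ.≤ a → b ℚ.≤ 1ℚ → MeshBelow η P →
  ∣ riemannSum ⟦ deriv F ⟧ P - (⟦ F ⟧ b - ⟦ F ⟧ a) ∣ ℚ.≤ (M * η) * (b - a))
riemannSum-deriv F with M , 0≤M , F-taylor ← taylor F = M , 0≤M , estimate
  where
  estimate : ∀ η {a b} (P : TaggedPartition a b) → 0ℚ ℚ.≤ a → b ℚ.≤ 1ℚ → MeshBelow η P →
    ∣ riemannSum ⟦ deriv F ⟧ P - (⟦ F ⟧ b - ⟦ F ⟧ a) ∣ ℚ.≤ (M * η) * (b - a)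
  estimate η {a} end 0≤a a≤1 _ = ℚ.≤-reflexive (trans
    (cong ∣_∣ (lem (⟦ F ⟧ a)))
    (sym (lem′ (M * η) a)))
    where
    lem : ∀ x → 0ℚ - (x - x) ≡ 0ℚ
    lem = solve-∀ ring
    lem′ : ∀ y x → y * (x - x) ≡ 0ℚ
    lem′ = solve-∀ ring
  estimate η {a} {b} (cell s c a≤s s≤c P) 0≤a b≤1 (c-a<η , mesh) = begin
    ∣ (f * h + R) - (⟦ F ⟧ b - ⟦ F ⟧ a) ∣
      ≡⟨ cong ∣_∣ (split (f * h) R (⟦ F ⟧ a) (⟦ F ⟧ c) (⟦ F ⟧ b)) ⟩
    ∣ - ((⟦ F ⟧ c - ⟦ F ⟧ a) - f * h) + (R - (⟦ F ⟧ b - ⟦ F ⟧ c)) ∣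
      ≤⟨ ∣∣-triangle
           (ℚ.≤-trans (ℚ.≤-reflexive (ℚ.∣-p∣≡∣p∣ ((⟦ F ⟧ c - ⟦ F ⟧ a) - f * h)))
             (F-taylor 0≤a a≤s s≤c (ℚ.≤-trans (partition-≤ P) b≤1)))
           (estimate η P (ℚ.≤-trans 0≤a a≤c) b≤1 mesh) ⟩
    M * (h * h) + (M * η) * (b - c)
      ≤⟨ ℚ.+-monoˡ-≤ ((M * η) * (b - c)) (*-monoˡ 0≤M (*-monoʳ (0≤- a≤c) (ℚ.<⇒≤ c-a<η))) ⟩
    M * (η * h) + (M * η) * (b - c)
      ≡⟨ collect M η a b c ⟩
    (M * η) * (b - a) ∎
    where
    a≤c = ℚ.≤-trans a≤s s≤c
    h = c - a
    f = ⟦ deriv F ⟧ s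
    R = riemannSum ⟦ deriv F ⟧ P
    split : ∀ x r fa fc fb → (x + r) - (fb - fa) ≡ - ((fc - fa) - x) + (r - (fb - fc))
    split = solve-∀ ring
    collect : ∀ M η a b c → M * (η * (c - a)) + (M * η) * (b - c) ≡ (M * η) * (b - a)
    collect = solve-∀ ring

polynomial-hasIntegral : ∀ p → HasIntegral ⟦ p ⟧ 0ℚ 1ℚ (∫₀¹ p)
polynomial-hasIntegral p ε 0<ε = η , 0<η , λ P mesh → begin-strict
    ∣ riemannSum ⟦ p ⟧ P - ∫₀¹ p ∣
      ≡⟨ cong₂ (λ q I → ∣ riemannSum ⟦ q ⟧ P - I ∣)
           (deriv-antideriv p) (F∣₀¹ (∫₀¹ p) (⟦ weigh reciprocal p ⟧ 0ℚ)) ⟨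
    ∣ riemannSum ⟦ deriv (antideriv p) ⟧ P - (⟦ antideriv p ⟧ 1ℚ - ⟦ antideriv p ⟧ 0ℚ) ∣
      ≤⟨ proj₂ (proj₂ (riemannSum-deriv (antideriv p))) η P ℚ.≤-refl ℚ.≤-refl mesh ⟩
    (M * η) * (1ℚ - 0ℚ)
      ≡⟨ ℚ.*-identityʳ (M * η) ⟩
    M * η
      <⟨ ℚ.*-monoˡ-<-pos η M<N ⟩
    N * η
      ≡⟨ N*η≡ε ⟩
    ε ∎
  where
  F∣₀¹ : ∀ I x → (0ℚ + 1ℚ * I) - (0ℚ + 0ℚ * x) ≡ I
  F∣₀¹ = solve-∀ ring
  M = proj₁ (riemannSum-deriv (antideriv p))
  -- `M` may be 0. Adding 1 permits the division in ε / N and makes M η < N η = ε strict.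
  N = M + 1ℚ
  0≤M : 0ℚ ℚ.≤ M
  0≤M = proj₁ (proj₂ (riemannSum-deriv (antideriv p)))
  M<N : M ℚ.< N
  M<N = ℚ.≤-<-trans (ℚ.≤-reflexive (sym (ℚ.+-identityʳ M))) (ℚ.+-monoʳ-< M (ℚ.positive⁻¹ 1ℚ))
  instance
    N-positive : ℚ.Positive N
    N-positive = ℚ.positive (ℚ.≤-<-trans 0≤M M<N)
    N-nonZero : ℚ.NonZero N
    N-nonZero = ℚ.pos⇒nonZero N
    1/N-positive : ℚ.Positive (ℚ.1/ N)
    1/N-positive = ℚ.1/pos⇒pos N
    ε-positive : ℚ.Positive ε
    ε-positive = ℚ.positive 0<ε
  η = ε * ℚ.1/ N
  instance
    η-positive : ℚ.Positive η
    η-positive = ℚ.pos*pos⇒pos ε (ℚ.1/ N)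
  0<η : 0ℚ ℚ.< η
  0<η = ℚ.positive⁻¹ η
  N*η≡ε : N * η ≡ ε
  N*η≡ε = begin-equality
    N * (ε * ℚ.1/ N)  ≡⟨ lem N ε (ℚ.1/ N) ⟩
    ε * (N * ℚ.1/ N)  ≡⟨ cong (ε *_) (ℚ.*-inverseʳ N) ⟩
    ε * 1ℚ            ≡⟨ ℚ.*-identityʳ ε ⟩
    ε                 ∎
    where
    lem : ∀ x y z → x * (y * z) ≡ y * (x * z)
    lem = solve-∀ ring

HasIntegral-cong : ∀ {f g a b I} → f ≗ g → HasIntegral f a b I → HasIntegral g a b I
HasIntegral-cong {f} {g} {I = I} f≗g f-int ε 0<ε with η , 0<η , close ← f-int ε 0<ε =
  η , 0<η , λ P mesh → subst (λ S → ∣ S - I ∣ ℚ.< ε) (riemannSum-cong P) (close P mesh)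
  where
  riemannSum-cong : ∀ {a b} (P : TaggedPartition a b) → riemannSum f P ≡ riemannSum g P
  riemannSum-cong end = refl
  riemannSum-cong (cell {a} s c _ _ P) = cong₂ (λ x r → x * (c - a) + r) (f≗g s) (riemannSum-cong P)

-- The generalized Gregory coefficients

L² : ℕ → ℚ
L² = L ⋆ L

-- Each derivative of (1+y)^(1-t) brings a factor -v, and the two signs cancel. The sequence `a` is
-- any solution of the recurrence, so that an explicit series can be used at an end point.
⟦A″⟧ : ∀ {x} t → 1ℚ + t * - 1ℚ ≡ x → ∀ {a} → IsBinomial x a → ∀ n → ⟦ A″ n ⟧ t ≡ (L ⋆ (L ⋆ a)) n
⟦A″⟧ t refl {a} isBin n = begin-equality
  ⟦ A″ n ⟧ t
    ≡⟨ linear-deriv-binomₚ 1ℚ (- 1ℚ) (∘deriv-linear (⟦⟧-linear t)) n ⟩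
  - 1ℚ * (L ⋆ (λ k → ⟦ deriv (A k) ⟧ t)) n
    ≡⟨ cong (- 1ℚ *_) (⋆-cong {L} (λ _ → refl) first n) ⟩
  - 1ℚ * (L ⋆ (λ k → - 1ℚ * (L ⋆ a) k)) n
    ≡⟨ cong (- 1ℚ *_) (⋆-*ʳ (- 1ℚ) L (L ⋆ a) n) ⟩
  - 1ℚ * (- 1ℚ * (L ⋆ (L ⋆ a)) n)
    ≡⟨ lem ((L ⋆ (L ⋆ a)) n) ⟩
  (L ⋆ (L ⋆ a)) n ∎
  where
  lem : ∀ x → - 1ℚ * (- 1ℚ * x) ≡ x
  lem = solve-∀ ring
  first : ∀ k → ⟦ deriv (A k) ⟧ t ≡ - 1ℚ * (L ⋆ a) k
  first k = trans
    (linear-deriv-binomₚ 1ℚ (- 1ℚ) (⟦⟧-linear t) k)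
    (cong (- 1ℚ *_) (⋆-cong {L} (λ _ → refl)
      (binomial-unique (binomₚ-isBinomial 1ℚ (- 1ℚ) t) isBin) k))

-- At t = 1 the exponent 1 - t is 0 and v² remains; at t = 0 it is 1 and the result is (1 + y) v².
⟦A″⟧-1 : ∀ n → ⟦ A″ n ⟧ 1ℚ ≡ L² n
⟦A″⟧-1 n = trans (⟦A″⟧ 1ℚ refl binomial-0 n) (⋆-cong {L} (λ _ → refl) (⋆δ L) n)

⟦A″⟧-0 : ∀ n → ⟦ A″ n ⟧ 0ℚ ≡ L² n + shift L² n
⟦A″⟧-0 n = begin-equality
  ⟦ A″ n ⟧ 0ℚ
    ≡⟨ ⟦A″⟧ 0ℚ refl binomial-1 n ⟩
  (L ⋆ (L ⋆ λ k → δ k + var k)) n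
    ≡⟨ ⋆-cong {L} (λ _ → refl) (λ k → trans (⋆-+ʳ L δ var k) (cong₂ _+_ (⋆δ L k) (⋆var L k))) n ⟩
  (L ⋆ (λ k → L k + shift L k)) n
    ≡⟨ ⋆-+ʳ L L (shift L) n ⟩
  L² n + (L ⋆ shift L) n
    ≡⟨ cong (_+_ (L² n)) (⋆-shift L L n) ⟩
  L² n + shift L² n ∎

⟦B⟧-1 : ∀ m → ⟦ B m ⟧ 1ℚ ≡ δ m + var m
⟦B⟧-1 = binomial-unique (binomₚ-isBinomial 0ℚ 1ℚ 1ℚ) binomial-1

⟦B⟧-0 : ∀ m → ⟦ B m ⟧ 0ℚ ≡ δ m
⟦B⟧-0 = binomial-unique (binomₚ-isBinomial 0ℚ 1ℚ 0ℚ) binomial-0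

J : Series
J m n = ∫₀¹ (mul (B m) (A″ n))

J-L⋆x : ∀ m n → (L ⋆ λ i → J i n) m ≡ ∫₀¹ (mul (deriv (B m)) (A″ n))
J-L⋆x m n = sym (trans
  (linear-deriv-binomₚ 0ℚ 1ℚ (∘mulʳ-linear ∫₀¹-linear (A″ n)) m)
  (ℚ.*-identityˡ ((L ⋆ λ i → J i n) m)))

-- The functional is p ↦ ∫₀¹ `B m` p″: it sends `A n` to `J m n`, and the derivative of `A n` to the
-- right-hand side.
J-L⋆y : ∀ m n → - 1ℚ * (L ⋆ J m) n ≡ ∫₀¹ (mul (B m) (deriv (A″ n)))
J-L⋆y m n = sym
  (linear-deriv-binomₚ 1ℚ (- 1ℚ) (∘deriv-linear (∘deriv-linear (∘mulˡ-linear ∫₀¹-linear (B m)))) n)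

-- The boundary terms are coefficients of (1 + x) v² at t = 1 and of (1 + y) v² at t = 0.
logX-logY-J : ∀ m n → (L ⋆ λ i → J i n) m + - 1ℚ * (L ⋆ J m) n ≡
  (δ m + var m) * L² n - δ m * (L² n + shift L² n)
logX-logY-J m n = begin-equality
  (L ⋆ λ i → J i n) m + - 1ℚ * (L ⋆ J m) n
    ≡⟨ cong₂ _+_ (J-L⋆x m n) (J-L⋆y m n) ⟩
  ∫₀¹ (mul (deriv (B m)) (A″ n)) + ∫₀¹ (mul (B m) (deriv (A″ n)))
    ≡⟨ ∫₀¹-by-parts (B m) (A″ n) ⟩
  ⟦ B m ⟧ 1ℚ * ⟦ A″ n ⟧ 1ℚ - ⟦ B m ⟧ 0ℚ * ⟦ A″ n ⟧ 0ℚ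
    ≡⟨ cong₂ _-_ (cong₂ _*_ (⟦B⟧-1 m) (⟦A″⟧-1 n)) (cong₂ _*_ (⟦B⟧-0 m) (⟦A″⟧-0 n)) ⟩
  (δ m + var m) * L² n - δ m * (L² n + shift L² n) ∎

numerator : Series
numerator = inY var *ₛ inX L ² -ₛ inX var *ₛ inY L ²

-- Turns the case distinction into a scalar factor, which `⋆-*ʳ` can pull out of a convolution.
inX-δ : ∀ f m n → inX f m n ≡ δ n * f m
inX-δ f m zero    = sym (ℚ.*-identityˡ (f m))
inX-δ f m (suc n) = sym (ℚ.*-zeroˡ (f m))

inY-δ : ∀ f m n → inY f m n ≡ δ m * f n
inY-δ f zero    n = sym (ℚ.*-identityˡ (f n))
inY-δ f (suc m) n = sym (ℚ.*-zeroˡ (f n))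

var⋆δ* : ∀ c n → (var ⋆ λ j → δ j * c) n ≡ var n * c
var⋆δ* c n = trans (var⋆ (λ j → δ j * c) n) (shift-δ* n)
  where
  shift-δ* : ∀ n → shift (λ j → δ j * c) n ≡ var n * c
  shift-δ* 0             = sym (ℚ.*-zeroˡ c)
  shift-δ* 1             = refl
  shift-δ* (suc (suc n)) = refl

numerator-coeff : ∀ m n → numerator m n ≡ var n * L² m - var m * L² n
numerator-coeff m n = cong₂ _-_ y·logX² x·logY²
  where
  y·logX² : (inY var *ₛ inX L ²) m n ≡ var n * L² m
  y·logX² = begin-equality
    (inY var *ₛ inX L ²) m n             ≡⟨ inY-*ₛ var (inX L ²) m n ⟩
    (var ⋆ (inX L ²) m) n                ≡⟨ ⋆-cong {var} (λ _ → refl) (λ j → begin-equality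
      (inX L ²) m j                        ≡⟨ inX-*ₛ L (inX L) m j ⟩
      (L ⋆ λ i → inX L i j) m              ≡⟨ ⋆-cong {L} (λ _ → refl) (λ i → inX-δ L i j) m ⟩
      (L ⋆ λ i → δ j * L i) m              ≡⟨ ⋆-*ʳ (δ j) L L m ⟩
      δ j * L² m                           ∎) n ⟩
    (var ⋆ λ j → δ j * L² m) n           ≡⟨ var⋆δ* (L² m) n ⟩
    var n * L² m                         ∎
  x·logY² : (inX var *ₛ inY L ²) m n ≡ var m * L² n
  x·logY² = begin-equality
    (inX var *ₛ inY L ²) m n             ≡⟨ inX-*ₛ var (inY L ²) m n ⟩
    (var ⋆ λ i → (inY L ²) i n) m        ≡⟨ ⋆-cong {var} (λ _ → refl) (λ i → begin-equality
      (inY L ²) i n                        ≡⟨ inY-*ₛ L (inY L) i n ⟩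
      (L ⋆ inY L i) n                      ≡⟨ ⋆-cong {L} (λ _ → refl) (λ j → inY-δ L i j) n ⟩
      (L ⋆ λ j → δ i * L j) n              ≡⟨ ⋆-*ʳ (δ i) L L n ⟩
      δ i * L² n                           ∎) m ⟩
    (var ⋆ λ i → δ i * L² n) m           ≡⟨ var⋆δ* (L² n) m ⟩
    var m * L² n                         ∎

⋆-linear₃ : ∀ a b c f g h n → (L ⋆ λ i → a * f i + (b * g i + c * h i)) n ≡
  a * (L ⋆ f) n + (b * (L ⋆ g) n + c * (L ⋆ h) n)
⋆-linear₃ a b c f g h n = trans
  (⋆-+ʳ L (λ i → a * f i) (λ i → b * g i + c * h i) n)
  (cong₂ _+_ (⋆-*ʳ a L f n)
    (trans (⋆-+ʳ L (λ i → b * g i) (λ i → c * h i) n) (cong₂ _+_ (⋆-*ʳ b L g n) (⋆-*ʳ c L h n))))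

-- With u = log(1+x) and v = log(1+y), logX-logY-J says (u - v) J = (x - y) v², and
-- (y u² - x v²) + (x - y) v² = (u - v) y (u + v).
gregory : Series
gregory m n = - 1ℚ * J m n + (var n * L m + shift L n * δ m)

gregory-isGeneralizedGregory : IsGeneralizedGregory gregory
gregory-isGeneralizedGregory m n = begin-equality
  (logX-logY *ₛ gregory) m n
    ≡⟨ logX-logY-*ₛ gregory m n ⟩
  (L ⋆ λ i → gregory i n) m - (L ⋆ gregory m) n
    ≡⟨ cong₂ _-_ xPart yPart ⟩
  (- 1ℚ * Jx + (var n * L² m + shift L n * L m)) - (- 1ℚ * Jy + (L m * shift L n + δ m * shift L² n))
    ≡⟨ lem Jx Jy (var n * L² m) (shift L n) (L m) (δ m * shift L² n) ⟩
  (var n * L² m - δ m * shift L² n) - (Jx + - 1ℚ * Jy)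
    ≡⟨ cong (_-_ (var n * L² m - δ m * shift L² n)) (logX-logY-J m n) ⟩
  (var n * L² m - δ m * shift L² n) - ((δ m + var m) * L² n - δ m * (L² n + shift L² n))
    ≡⟨ lem′ (var n * L² m) (δ m) (shift L² n) (var m) (L² n) ⟩
  var n * L² m - var m * L² n
    ≡⟨ numerator-coeff m n ⟨
  numerator m n ∎
  where
  Jx = (L ⋆ λ i → J i n) m
  Jy = (L ⋆ J m) n
  xPart : (L ⋆ λ i → gregory i n) m ≡ - 1ℚ * Jx + (var n * L² m + shift L n * L m)
  xPart = trans
    (⋆-linear₃ (- 1ℚ) (var n) (shift L n) (λ i → J i n) L δ m)
    (cong (λ z → - 1ℚ * Jx + (var n * L² m + shift L n * z)) (⋆δ L m))
  yPart : (L ⋆ gregory m) n ≡ - 1ℚ * Jy + (L m * shift L n + δ m * shift L² n)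
  yPart = begin-equality
    (L ⋆ gregory m) n
      ≡⟨ ⋆-cong {L} (λ _ → refl) (λ j → cong (_+_ (- 1ℚ * J m j))
           (cong₂ _+_ (ℚ.*-comm (var j) (L m)) (ℚ.*-comm (shift L j) (δ m)))) n ⟩
    (L ⋆ λ j → - 1ℚ * J m j + (L m * var j + δ m * shift L j)) n
      ≡⟨ ⋆-linear₃ (- 1ℚ) (L m) (δ m) (J m) var (shift L) n ⟩
    - 1ℚ * Jy + (L m * (L ⋆ var) n + δ m * (L ⋆ shift L) n)
      ≡⟨ cong₂ (λ u v → - 1ℚ * Jy + (L m * u + δ m * v)) (⋆var L n) (⋆-shift L L n) ⟩
    - 1ℚ * Jy + (L m * shift L n + δ m * shift L² n) ∎
  lem : ∀ jx jy a s l d →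
    (- 1ℚ * jx + (a + s * l)) - (- 1ℚ * jy + (l * s + d)) ≡ (a - d) - (jx + - 1ℚ * jy)
  lem = solve-∀ ring
  lem′ : ∀ a d s v q → (a - d * s) - ((d + v) * q - d * (q + s)) ≡ a - v * q
  lem′ = solve-∀ ring

-- Cancels the constant of `eval-stirling` against the one in front of the integral. Their powers of
-- -1 differ by one in the exponent, hence the remaining sign.
prefactor : ∀ n → ((+ 2 ℤ.* -1ℤ ℤ.^ n) / (suc n !)) {{suc n !≢0}} * (½ * signed! (suc n)) ≡ - 1ℚ
prefactor n = begin-equality
  q * (½ * (sign (suc n) * ι (suc n !)))
    ≡⟨ lem q ½ (sign (suc n)) (ι (suc n !)) ⟩
  (q * ι (suc n !)) * (½ * sign (suc n))
    ≡⟨ cong₂ (λ u v → u * (½ * v))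
         (trans (/-*-cancel (+ 2 ℤ.* -1ℤ ℤ.^ n) (suc n !) {{suc n !≢0}}) (/1-homo-* (+ 2) (-1ℤ ℤ.^ n)))
         (sign-suc n) ⟩
  (ι 2 * sign n) * (½ * (- 1ℚ * sign n))
    ≡⟨ lem′ (ι 2) (sign n) ½ ⟩
  (ι 2 * ½) * (- 1ℚ * (sign n * sign n))
    ≡⟨ cong (λ s → (ι 2 * ½) * (- 1ℚ * s)) (sign² n) ⟩
  - 1ℚ ∎
  where
  q = ((+ 2 ℤ.* -1ℤ ℤ.^ n) / (suc n !)) {{suc n !≢0}}
  lem : ∀ q h s f → q * (h * (s * f)) ≡ (q * f) * (h * s)
  lem = solve-∀ ring
  lem′ : ∀ t s h → (t * s) * (h * (- 1ℚ * s)) ≡ (t * h) * (- 1ℚ * (s * s))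
  lem′ = solve-∀ ring

theorem5p3 : (G : ℕ → ℕ → ℚ) → IsGeneralizedGregory G →
    ∀ m n → 1 ≤ m → 2 ≤ n →
    ∃ λ (I : ℚ) →
    HasIntegral (λ t → binom t m ℚ.* eval (stirling n 2) (t ℚ.- 1ℚ)) 0ℚ 1ℚ I ×
    G m n ≡ ((+ 2 ℤ.* -1ℤ ℤ.^ (n ∸ 1)) / (n !)) {{n !≢0}} ℚ.* I
theorem5p3 G isGregory m@(suc m-1) n@(suc (suc n-2)) (s≤s z≤n) (s≤s (s≤s z≤n)) =
  ∫₀¹ integrand , HasIntegral-cong ⟦integrand⟧ (polynomial-hasIntegral integrand) , (begin-equality
    G m n                                      ≡⟨ quotient-unique numerator G gregory isGregory gregory-isGeneralizedGregory m n ⟩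
    -- The two zeros are `var n` for n ≥ 2 and `δ m` for m ≥ 1.
    - 1ℚ * J m n + (0ℚ * L m + L (suc n-2) * 0ℚ)  ≡⟨ lem (J m n) (L m) (L (suc n-2)) ⟩
    - 1ℚ * J m n                               ≡⟨ cong (_* J m n) (prefactor (suc n-2)) ⟨
    q * (½ * signed! n) * J m n                ≡⟨ ℚ.*-assoc q (½ * signed! n) (J m n) ⟩
    q * ((½ * signed! n) * J m n)
      ≡⟨ cong (q *_) (scale-homo ∫₀¹-linear (½ * signed! n) (mul (B m) (A″ n))) ⟨
    q * ∫₀¹ integrand                          ∎)
  where
  q = ((+ 2 ℤ.* -1ℤ ℤ.^ suc n-2) / (n !)) {{n !≢0}}
  integrand : Poly
  integrand = scale (½ * signed! n) (mul (B m) (A″ n))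
  lem : ∀ j l l′ → - 1ℚ * j + (0ℚ * l + l′ * 0ℚ) ≡ - 1ℚ * j
  lem = solve-∀ ring
  lem′ : ∀ k b a → k * (b * a) ≡ b * (k * a)
  lem′ = solve-∀ ring
  ⟦integrand⟧ : ∀ t → ⟦ integrand ⟧ t ≡ binom t m * eval (stirling n 2) (t - 1ℚ)
  ⟦integrand⟧ t = begin-equality
    ⟦ integrand ⟧ t
      ≡⟨ ⟦scale⟧ (½ * signed! n) (mul (B m) (A″ n)) t ⟩
    ½ * signed! n * ⟦ mul (B m) (A″ n) ⟧ t
      ≡⟨ cong (½ * signed! n *_) (⟦mul⟧ (B m) (A″ n) t) ⟩
    ½ * signed! n * (⟦ B m ⟧ t * ⟦ A″ n ⟧ t)
      ≡⟨ lem′ (½ * signed! n) (⟦ B m ⟧ t) (⟦ A″ n ⟧ t) ⟩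
    ⟦ B m ⟧ t * (½ * signed! n * ⟦ A″ n ⟧ t)
      ≡⟨ cong₂ _*_ (⟦B⟧ m t) (sym (eval-stirling n t)) ⟩
    binom t m * eval (stirling n 2) (t - 1ℚ) ∎
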